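{- Let $n$ be a positive integer, and put $$r_1:=\left\lfloor\frac{3n-1-\sqrt{12n+13}}{3}\right\rfloor+1,\qquad r_2:=\left\lceil\frac{3n-1+\sqrt{12n+13}}{3}\right\rceil-1.$$ Then $$\frac{1}{\Theta_6(q)}=q^{ -\frac{3n^2+n}{2}}\sum_{\substack{k=r_1\\ k\equiv n\ (\mathrm{mod}\ 2)}}^{r_2}(-1)^{\frac{n-k}{2}}A_k(q)\,C_{\frac{3n-k}{2}}(q)+O(q^{n+1}).$$
   Context: Here $(a;q)_\infty:=\prod_{j=0}^\infty(1-aq^j)$, and $O(q^{n+1})$ denotes a formal power series in $q$ all of whose terms have exponent at least $n+1$. The theta function is $$\Theta_6(q):=(q;q)_\infty^3(q;q^2)_\infty^2=\frac12\sum_{n\in\mathbb Z}\chi_6(n)\,n\,q^{\frac{n^2-1}{24}},$$ where $\chi_6(n)=1$ if $n\equiv1\pmod 6$, $\chi_6(n)=-1$ if $n\equiv-1\pmod 6$, and $0$ otherwise. For integers $k\ge0$, $$A_k(q):=\sum_{0<t_1<\cdots<t_k}\frac{q^{t_1+\cdots+t_k}}{(1-q^{t_1})^2\cdots(1-q^{t_k})^2},\qquad C_k(q):=\sum_{0<t_1<\cdots<t_k}\frac{q^{2t_1+\cdots+2t_k-k}}{(1-q^{2t_1-1})^2\cdots(1-q^{2t_k-1})^2},$$ with $A_0(q)=C_0(q)=1$. -}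

module Defs where

open import Algebra.Bundles using (RawRing)
import Algebra.Definitions.RawSemiring as RawSemiringDefs
open import Data.Fin.Base using (Fin; zero; suc; toℕ)
open import Data.Fin.Properties using (toℕ≤pred[n])
open import Data.Integer.Base
  using (ℤ; +_; -[1+_]; +[1+_]; _+_; _*_; _-_; -_; ∣_∣; _⊔_; _≤_; _<_; 0ℤ; 1ℤ; -1ℤ; +≤+; -≤+; +<+)
open import Data.Integer.Divisibility.Signed using (_∣?_)
import Data.Integer.Properties as ℤ
open import Data.Integer.Tactic.RingSolver using (solve-∀)
open import Data.List.Base using (List; []; _∷_; _++_; map; filter; foldr; upTo)
open import Data.List.Relation.Unary.All using (All; []; _∷_; universal)
import Data.List.Relation.Unary.All.Properties as All
open import Data.Nat.Base as ℕ using (ℕ; zero; suc; _∸_; z≤n; s≤s)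
open import Data.Nat.ListAction using (sum)
import Data.Nat.Properties as ℕ
open import Data.Product.Base using (∃; _×_; _,_; proj₁; proj₂)
open import Data.Sign.Base as Sign using (Sign)
open import Data.Sum.Base using (_⊎_; inj₁; inj₂)
open import Data.Vec.Base using (Vec; []; _∷_; head; lookup)
open import Function.Base using (id; _∘_)
open import Level using (0ℓ)
open import Relation.Binary.PropositionalEquality
  using (_≡_; refl; sym; trans; cong; cong₂; subst; module ≡-Reasoning)
open import Relation.Nullary using (¬_; Dec; yes; no; contradiction)
open import Relation.Nullary.Decidable using (_⊎-dec_; _×-dec_)

open import Algebra.Properties.Semiring.Sum ℤ.+-*-semiring
  using (sum⁺-syntax; sum-syntax; sum-cong-≗; sum-replicate-zero)
  renaming (sum to sumᶠ)

------------------------------------------------------------------------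
-- Formal power series in q over ℤ, as sequences of coefficients

PowerSeries : Set
PowerSeries = ℕ → ℤ

infix  4 _≈ₛ_
infixl 6 _+ₛ_ _-ₛ_
infixl 7 _*ₛ_ _/ₛ_ _·ₛ_

_≈ₛ_ : PowerSeries → PowerSeries → Set
f ≈ₛ g = ∀ m → f m ≡ g m

0ₛ 1ₛ q : PowerSeries
0ₛ _       = 0ℤ
1ₛ zero    = 1ℤ
1ₛ (suc _) = 0ℤ
q 1        = 1ℤ
q _        = 0ℤ

-ₛ_ : PowerSeries → PowerSeries
(-ₛ f) m = - f m

_+ₛ_ _-ₛ_ _*ₛ_ : PowerSeries → PowerSeries → PowerSeries
(f +ₛ g) m = f m + g m
(f -ₛ g) m = f m - g m
(f *ₛ g) m = ∑[ i ≤ m ] (f (toℕ i) * g (m ∸ toℕ i))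

_·ₛ_ : ℤ → PowerSeries → PowerSeries
(c ·ₛ f) m = c * f m

powerSeries : RawRing 0ℓ 0ℓ
powerSeries = record
  { Carrier = PowerSeries
  ; _≈_     = _≈ₛ_
  ; _+_     = _+ₛ_
  ; _*_     = _*ₛ_
  ; -_      = -ₛ_
  ; 0#      = 0ₛ
  ; 1#      = 1ₛ
  }

open RawSemiringDefs (RawRing.rawSemiring powerSeries) public
  using () renaming (_^_ to _^ₛ_)

sumOver : {I : Set} → List I → (I → PowerSeries) → PowerSeries
sumOver is f = foldr _+ₛ_ 0ₛ (map f is)

productOver : {I : Set} → List I → (I → PowerSeries) → PowerSeries
productOver is f = foldr _*ₛ_ 1ₛ (map f is)

-- O[q^ k ] f : f is a power series all of whose terms have exponent at
-- least k.

O[q^_] : ℕ → PowerSeries → Set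
O[q^ k ] f = ∀ m → m ℕ.< k → f m ≡ 0ℤ

------------------------------------------------------------------------
-- Elementary facts about coefficients

sumᶠ-zero : ∀ {n} (t : Fin n → ℤ) → (∀ i → t i ≡ 0ℤ) → sumᶠ t ≡ 0ℤ
sumᶠ-zero {n} t t≡0 = trans (sum-cong-≗ t≡0) (sum-replicate-zero n)

*ₛ-constant : ∀ f g → (f *ₛ g) 0 ≡ f 0 * g 0
*ₛ-constant f g = ℤ.+-identityʳ (f 0 * g 0)

*ₛ-constant-1 : ∀ f g → f 0 ≡ 1ℤ → g 0 ≡ 1ℤ → (f *ₛ g) 0 ≡ 1ℤ
*ₛ-constant-1 f g f₀ g₀ = trans (*ₛ-constant f g) (cong₂ _*_ f₀ g₀)

^ₛ-constant-1 : ∀ f n → f 0 ≡ 1ℤ → (f ^ₛ n) 0 ≡ 1ℤ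
^ₛ-constant-1 f zero    f₀ = refl
^ₛ-constant-1 f (suc n) f₀ = *ₛ-constant-1 f (f ^ₛ n) f₀ (^ₛ-constant-1 f n f₀)

*ₛ-order : ∀ {a b} f g → O[q^ a ] f → O[q^ b ] g → O[q^ a ℕ.+ b ] (f *ₛ g)
*ₛ-order {a} {b} f g Of Og m m<a+b = sumᶠ-zero (λ i → f (toℕ i) * g (m ∸ toℕ i)) λ i → term (toℕ i) (toℕ≤pred[n] i)
  where
  term : ∀ i → i ℕ.≤ m → f i * g (m ∸ i) ≡ 0ℤ
  term i i≤m with i ℕ.<? a
  ... | yes i<a = trans (cong (_* g (m ∸ i)) (Of i i<a)) (ℤ.*-zeroˡ (g (m ∸ i)))
  ... | no  i≮a = trans (cong (f i *_) (Og (m ∸ i) m∸i<b)) (ℤ.*-zeroʳ (f i))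
    where
    m∸i<b : m ∸ i ℕ.< b
    m∸i<b = ℕ.+-cancelˡ-< i (m ∸ i) b (subst (ℕ._< i ℕ.+ b) (sym (ℕ.m+[n∸m]≡n i≤m))
      (ℕ.<-≤-trans m<a+b (ℕ.+-monoˡ-≤ b (ℕ.≮⇒≥ i≮a))))

*ₛ-orderˡ : ∀ {a} f g → O[q^ a ] f → O[q^ a ] (f *ₛ g)
*ₛ-orderˡ {a} f g Of m m<a =
  *ₛ-order f g Of (λ _ ()) m (subst (m ℕ.<_) (sym (ℕ.+-identityʳ a)) m<a)

^ₛ-order : ∀ f n → f 0 ≡ 0ℤ → O[q^ n ] (f ^ₛ n)
^ₛ-order f zero    f₀ = λ _ ()
^ₛ-order f (suc n) f₀ = *ₛ-order {1} f (f ^ₛ n) (λ { zero _ → f₀ ; (suc _) (s≤s ()) }) (^ₛ-order f n f₀)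

1-O*ₛ : ∀ {k} u f → O[q^ k ] u → ∀ m → m ℕ.< k → ((1ₛ -ₛ u) *ₛ f) m ≡ f m
1-O*ₛ {k} u f Ou m m<k = begin
  (1ℤ - u 0) * f m + rest        ≡⟨ cong₂ _+_ first rest≡0 ⟩
  f m + 0ℤ                       ≡⟨ ℤ.+-identityʳ (f m) ⟩
  f m                            ∎
  where
  open ≡-Reasoning
  rest = ∑[ i < m ] ((0ℤ - u (suc (toℕ i))) * f (m ∸ suc (toℕ i)))
  first : (1ℤ - u 0) * f m ≡ f m
  first = trans (cong (λ x → (1ℤ - x) * f m) (Ou 0 (ℕ.≤-<-trans z≤n m<k))) (ℤ.*-identityˡ (f m))
  u-suc : (i : Fin m) → u (suc (toℕ i)) ≡ 0ℤ
  u-suc i = Ou _ (ℕ.≤-<-trans (toℕ<m i) m<k)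
    where
    toℕ<m : ∀ {m} (i : Fin m) → suc (toℕ i) ℕ.≤ m
    toℕ<m {suc _} i = s≤s (toℕ≤pred[n] i)
  rest≡0 : rest ≡ 0ℤ
  rest≡0 = sumᶠ-zero (λ i → (0ℤ - u (suc (toℕ i))) * f (m ∸ suc (toℕ i))) λ i →
    trans (cong (λ x → (0ℤ - x) * f (m ∸ suc (toℕ i))) (u-suc i)) (ℤ.*-zeroˡ (f (m ∸ suc (toℕ i))))

------------------------------------------------------------------------
-- Reciprocals.  The value of f ⁻¹ is the reciprocal of f when f has
-- constant term 1 (see *ₛ-inverseʳ); it is only ever applied to such f.

-- inverseCoefficients f n = [ gₙ₋₁ , … , g₁ , g₀ ], where g₀ = 1 and
-- gₙ = - (f₁ gₙ₋₁ + … + fₙ g₀) for n > 0.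

nextCoefficient : PowerSeries → (n : ℕ) → Vec ℤ n → ℤ
nextCoefficient f zero    [] = 1ℤ
nextCoefficient f (suc n) gs = - (∑[ i ≤ n ] (f (suc (toℕ i)) * lookup gs i))

inverseCoefficients : PowerSeries → (n : ℕ) → Vec ℤ n
inverseCoefficients f zero    = []
inverseCoefficients f (suc n) = nextCoefficient f n gs ∷ gs
  where gs = inverseCoefficients f n

infix 8 _⁻¹

_⁻¹ : PowerSeries → PowerSeries
(f ⁻¹) m = head (inverseCoefficients f (suc m))

_/ₛ_ : PowerSeries → PowerSeries → PowerSeries
f /ₛ g = f *ₛ g ⁻¹

lookup-inverse : ∀ f n (i : Fin (suc n)) → lookup (inverseCoefficients f (suc n)) i ≡ (f ⁻¹) (n ∸ toℕ i)
lookup-inverse f n       zero    = refl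
lookup-inverse f (suc n) (suc i) = lookup-inverse f n i

*ₛ-inverseʳ : ∀ f → f 0 ≡ 1ℤ → f *ₛ f ⁻¹ ≈ₛ 1ₛ
*ₛ-inverseʳ f f₀ zero    = *ₛ-constant-1 f (f ⁻¹) f₀ refl
*ₛ-inverseʳ f f₀ (suc m) = begin
  f 0 * - s + ∑[ i ≤ m ] (f (suc (toℕ i)) * (f ⁻¹) (m ∸ toℕ i))
    ≡⟨ cong₂ _+_ (trans (cong (_* - s) f₀) (ℤ.*-identityˡ (- s)))
         (sum-cong-≗ λ i → cong (f (suc (toℕ i)) *_) (sym (lookup-inverse f m i))) ⟩
  - s + s
    ≡⟨ ℤ.+-inverseˡ s ⟩
  0ℤ ∎
  where
  open ≡-Reasoning
  s = ∑[ i ≤ m ] (f (suc (toℕ i)) * lookup (inverseCoefficients f (suc m)) i)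

------------------------------------------------------------------------
-- Limits of sequences of power series (in the q-adic topology)

record Convergent (s : ℕ → PowerSeries) : Set where
  field
    modulus : ℕ → ℕ
    stable  : ∀ m {N} → modulus m ℕ.≤ N → s N m ≡ s (modulus m) m

lim : (s : ℕ → PowerSeries) → Convergent s → PowerSeries
lim s c m = s (Convergent.modulus c m) m

eventuallyConstant⇒convergent : ∀ s → (∀ m {N} → m ℕ.< N → s (suc N) m ≡ s N m) → Convergent s
eventuallyConstant⇒convergent s step = record { modulus = suc ; stable = λ m → go m ∘ ℕ.≤⇒≤′ }
  where
  go : ∀ m {N} → suc m ℕ.≤′ N → s N m ≡ s (suc m) m
  go m (ℕ.≤′-reflexive refl) = refl
  go m (ℕ.≤′-step m<N)       = trans (step m (ℕ.≤′⇒≤ m<N)) (go m m<N)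

------------------------------------------------------------------------
-- (a;p)_∞ = ∏_{j ≥ 0} (1 - a pʲ), for p without constant term

pochhammer : (a p : PowerSeries) → ℕ → PowerSeries
pochhammer a p zero    = 1ₛ
pochhammer a p (suc N) = (1ₛ -ₛ a *ₛ p ^ₛ N) *ₛ pochhammer a p N

pochhammer-convergent : ∀ a p → p 0 ≡ 0ℤ → Convergent (pochhammer a p)
pochhammer-convergent a p p₀ = eventuallyConstant⇒convergent (pochhammer a p) λ m {N} m<N →
  1-O*ₛ {N} (a *ₛ p ^ₛ N) (pochhammer a p N)
    (*ₛ-order {0} a (p ^ₛ N) (λ _ ()) (^ₛ-order p N p₀)) m m<N

⦅_⨾_⦆∞ : (a p : PowerSeries) {p₀ : p 0 ≡ 0ℤ} → PowerSeries
⦅_⨾_⦆∞ a p {p₀} = lim (pochhammer a p) (pochhammer-convergent a p p₀)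

Θ₆ : PowerSeries
Θ₆ = ⦅_⨾_⦆∞ q q {refl} ^ₛ 3 *ₛ ⦅_⨾_⦆∞ q (q ^ₛ 2) {refl} ^ₛ 2

Θ₆-constant : Θ₆ 0 ≡ 1ℤ
Θ₆-constant = refl

------------------------------------------------------------------------
-- The series A_k and C_k

-- The k-tuples 0 < t₁ < ⋯ < t_k ≤ N, each listed as [ t_k , … , t₁ ].

increasingTuples : (k N : ℕ) → List (List ℕ)
increasingTuples zero    N       = [] ∷ []
increasingTuples (suc k) zero    = []
increasingTuples (suc k) (suc N) =
  increasingTuples (suc k) N ++ map (suc N ∷_) (increasingTuples k N)

-- q^{e(t₁)+⋯+e(t_k)} / ((1 - q^{e(t₁)})² ⋯ (1 - q^{e(t_k)})²)

denominator : (e : ℕ → ℕ) → List ℕ → PowerSeries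
denominator e ts = productOver ts (λ t → (1ₛ -ₛ q ^ₛ e t) ^ₛ 2)

summand : (e : ℕ → ℕ) → List ℕ → PowerSeries
summand e ts = q ^ₛ sum (map e ts) /ₛ denominator e ts

denominator-constant : ∀ e ts → All (λ t → 0 ℕ.< e t) ts → denominator e ts 0 ≡ 1ℤ
denominator-constant e []       []         = refl
denominator-constant e (t ∷ ts) (0<et ∷ h) =
  *ₛ-constant-1 ((1ₛ -ₛ q ^ₛ e t) ^ₛ 2) (denominator e ts)
    (^ₛ-constant-1 (1ₛ -ₛ q ^ₛ e t) 2 (cong (λ c → 1ℤ - c) (^ₛ-order q (e t) refl 0 0<et)))
    (denominator-constant e ts h)

partialSum : (e : ℕ → ℕ) → ℕ → ℕ → PowerSeries
partialSum e k N = sumOver (increasingTuples k N) (summand e)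

sumOver-++ : ∀ {I : Set} (is js : List I) f → sumOver (is ++ js) f ≈ₛ sumOver is f +ₛ sumOver js f
sumOver-++ []       js f m = sym (ℤ.+-identityˡ (sumOver js f m))
sumOver-++ (i ∷ is) js f m = trans (cong (λ c → f i m + c) (sumOver-++ is js f m))
  (sym (ℤ.+-assoc (f i m) (sumOver is f m) (sumOver js f m)))

sumOver-order : ∀ {I : Set} {k} (is : List I) f → All (λ i → O[q^ k ] (f i)) is → O[q^ k ] (sumOver is f)
sumOver-order []       f []       m m<k = refl
sumOver-order (i ∷ is) f (o ∷ os) m m<k = cong₂ _+_ (o m m<k) (sumOver-order is f os m m<k)

partialSum-convergent : ∀ e → (∀ t → t ℕ.≤ e t) → ∀ k → Convergent (partialSum e k)
partialSum-convergent e t≤et zero    = eventuallyConstant⇒convergent (partialSum e 0) (λ _ _ → refl)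
partialSum-convergent e t≤et (suc k) = eventuallyConstant⇒convergent (partialSum e (suc k)) λ m {N} m<N →
  let old = increasingTuples (suc k) N
      new = map (suc N ∷_) (increasingTuples k N)
  in trans (sumOver-++ old new (summand e) m)
    (trans (cong (λ c → partialSum e (suc k) N m + c) (sumOver-order new (summand e) (small N) m m<N))
      (ℤ.+-identityʳ (partialSum e (suc k) N m)))
  where
  order : ∀ N ts → O[q^ N ] (summand e (suc N ∷ ts))
  order N ts = *ₛ-orderˡ (q ^ₛ d) (denominator e (suc N ∷ ts) ⁻¹) λ m m<N →
    ^ₛ-order q d refl m (ℕ.<-≤-trans m<N
      (ℕ.≤-trans (ℕ.n≤1+n N) (ℕ.≤-trans (t≤et (suc N)) (ℕ.m≤m+n (e (suc N)) (sum (map e ts))))))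
    where d = sum (map e (suc N ∷ ts))
  small : ∀ N → All (λ ts → O[q^ N ] (summand e ts)) (map (suc N ∷_) (increasingTuples k N))
  small N = All.map⁺ (universal (order N) (increasingTuples k N))

A : ℕ → PowerSeries
A k = lim (partialSum id k) (partialSum-convergent id (λ _ → ℕ.≤-refl) k)

odd : ℕ → ℕ
odd t = 2 ℕ.* t ∸ 1

t≤odd : ∀ t → t ℕ.≤ odd t
t≤odd zero    = z≤n
t≤odd (suc t) = ℕ.≤-trans (ℕ.m≤n+m (suc t) t) (ℕ.+-monoʳ-≤ t (s≤s (ℕ.m≤m+n t 0)))

-- The exponent 2t₁ + ⋯ + 2t_k - k is the sum of the exponents 2tᵢ - 1.

C : ℕ → PowerSeries
C k = lim (partialSum odd k) (partialSum-convergent odd t≤odd k)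

empty-sum : ∀ e t≤et → lim (partialSum e 0) (partialSum-convergent e t≤et 0) ≈ₛ 1ₛ
empty-sum e t≤et m = begin
  (1ₛ *ₛ 1ₛ ⁻¹) m + 0ℤ  ≡⟨ ℤ.+-identityʳ ((1ₛ *ₛ 1ₛ ⁻¹) m) ⟩
  (1ₛ *ₛ 1ₛ ⁻¹) m       ≡⟨ *ₛ-inverseʳ 1ₛ refl m ⟩
  1ₛ m                  ∎
  where open ≡-Reasoning

A-zero : A 0 ≈ₛ 1ₛ
A-zero = empty-sum id (λ _ → ℕ.≤-refl)

C-zero : C 0 ≈ₛ 1ₛ
C-zero = empty-sum odd t≤odd

-- Integer-indexed access to A and C.  The indices k and (3n - k) / 2
-- occurring for r₁ ≤ k ≤ r₂ and n > 0 are never negative, so the value at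
-- negative indices plays no role.

infixl 9 _⟨_⟩

_⟨_⟩ : (ℕ → PowerSeries) → ℤ → PowerSeries
F ⟨ + k ⟩      = F k
F ⟨ -[1+ _ ] ⟩ = 0ₛ

------------------------------------------------------------------------
-- Floor and ceiling of the real numbers (a + ε√D) / c, with ε a sign

record Surd : Set where
  constructor surd
  field
    a : ℤ
    ε : Sign
    D : ℕ
    c : ℕ
    .{{c≢0}} : ℕ.NonZero c

negate : Surd → Surd
negate (surd a ε D c) = surd (- a) (Sign.opposite ε) D c

-- p ≤ ε√D, where √D is the nonnegative real with square D

infix 4 _≤[_]√_ _≤?[_]√_

_≤[_]√_ : ℤ → Sign → ℕ → Set
p ≤[ Sign.+ ]√ D = p ≤ 0ℤ ⊎ p * p ≤ + D
p ≤[ Sign.- ]√ D = p ≤ 0ℤ × + D ≤ p * p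

infix 4 _≤ˢ_ _ˢ≤_ _<ˢ_ _ˢ<_

_≤ˢ_ _<ˢ_ : ℤ → Surd → Set
_ˢ≤_ _ˢ<_ : Surd → ℤ → Set
m ≤ˢ (surd a ε D c) = (+ c * m - a) ≤[ ε ]√ D
x ˢ≤ m = - m ≤ˢ negate x
x ˢ< m = ¬ (m ≤ˢ x)
m <ˢ x = ¬ (x ˢ≤ m)

IsFloor IsCeiling : Surd → ℤ → Set
IsFloor   x m = m ≤ˢ x × x ˢ< m + 1ℤ
IsCeiling x m = m - 1ℤ <ˢ x × x ˢ≤ m

_≤?[_]√_ : ∀ p ε D → Dec (p ≤[ ε ]√ D)
p ≤?[ Sign.+ ]√ D = (p ℤ.≤? 0ℤ) ⊎-dec (p * p ℤ.≤? + D)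
p ≤?[ Sign.- ]√ D = (p ℤ.≤? 0ℤ) ×-dec (+ D ℤ.≤? p * p)

search : (P : ℤ → Set) → (∀ m → Dec (P m)) → ∀ N lo → P lo → ¬ P (lo + + N) →
         ∃ λ m → P m × ¬ P (m + 1ℤ)
search P P? zero    lo Plo ¬Phi = contradiction (subst P (sym (ℤ.+-identityʳ lo)) Plo) ¬Phi
search P P? (suc N) lo Plo ¬Phi with P? (lo + 1ℤ)
... | no ¬P = lo , Plo , ¬P
... | yes p = search P P? N (lo + 1ℤ) p (¬Phi ∘ subst P (ℤ.+-assoc lo 1ℤ (+ N)))

square-≥ : ∀ D {X} → D ℕ.≤ X → D ℕ.≤ X ℕ.* X
square-≥ D {zero}  D≤X = D≤X
square-≥ D {suc X} D≤X = ℕ.≤-trans D≤X (ℕ.m≤m*n (suc X) (suc X))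

below : ∀ ε D {p} → p ≤ - + D → p ≤[ ε ]√ D
below ε D {+ zero} p≤-D with D | p≤-D
below Sign.+ D {+ zero} p≤-D | zero | _ = inj₁ ℤ.≤-refl
below Sign.- D {+ zero} p≤-D | zero | _ = ℤ.≤-refl , ℤ.≤-refl
below ε D {+[1+ p ]} p≤-D with D | p≤-D
... | zero  | +≤+ ()
... | suc _ | ()
below Sign.+ D { -[1+ p ]} p≤-D = inj₁ -≤+
below Sign.- D { -[1+ p ]} p≤-D = -≤+ , +≤+ (square-≥ D (ℤ.drop‿+≤+ (subst (_≤ +[1+ p ]) (ℤ.neg-involutive (+ D)) (ℤ.neg-mono-≤ p≤-D))))

above : ∀ ε D {p} → + D < p → ¬ (p ≤[ ε ]√ D)
above Sign.+ D {+ zero} (+<+ ())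
above Sign.+ D {+[1+ p ]} D<p (inj₁ (+≤+ ()))
above Sign.+ D {+[1+ p ]} (+<+ D<p) (inj₂ (+≤+ p²≤D)) =
  ℕ.<⇒≱ D<p (ℕ.≤-trans (ℕ.m≤m*n (suc p) (suc p)) p²≤D)
above Sign.- D (+<+ D<p) (+≤+ z≤n , _) = contradiction D<p ℕ.n≮0

⌊_⌋ˢ : (x : Surd) → ∃ (IsFloor x)
⌊ x@(surd a ε D c) ⌋ˢ = search (_≤ˢ x) (λ m → (+ c * m - a) ≤?[ ε ]√ D) (suc B ℕ.+ B) (- + B)
  (below ε D lower) (above ε D upper)
  where
  open ℤ.≤-Reasoning
  B = ∣ a ∣ ℕ.+ D
  i≤∣i∣ : ∀ i → i ≤ + ∣ i ∣
  i≤∣i∣ (+ n)    = ℤ.≤-refl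
  i≤∣i∣ -[1+ n ] = -≤+
  scale : ∀ n → + n ≤ + c * + n
  scale n = subst (+ n ≤_) (ℤ.pos-* c n) (+≤+ (ℕ.m≤n*m n c))
  cancel : ∀ x y → - (x + y) + x ≡ - y
  cancel = solve-∀
  cancel′ : ∀ x y → y ≡ (x + y) - x
  cancel′ = solve-∀
  cancel″ : ∀ x y → y ≡ - x + (y + x)
  cancel″ = solve-∀
  lower : + c * - + B - a ≤ - + D
  lower = begin
    + c * - + B - a          ≡⟨ cong (_- a) (ℤ.neg-distribʳ-* (+ c) (+ B)) ⟨
    - (+ c * + B) - a        ≤⟨ ℤ.+-monoˡ-≤ (- a) (ℤ.neg-mono-≤ (scale B)) ⟩
    - (+ ∣ a ∣ + + D) + - a  ≤⟨ ℤ.+-monoʳ-≤ (- (+ ∣ a ∣ + + D)) (i≤∣i∣ (- a)) ⟩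
    - (+ ∣ a ∣ + + D) + + ∣ - a ∣  ≡⟨ cong (λ x → - (+ ∣ a ∣ + + D) + + x) (ℤ.∣-i∣≡∣i∣ a) ⟩
    - (+ ∣ a ∣ + + D) + + ∣ a ∣    ≡⟨ cancel (+ ∣ a ∣) (+ D) ⟩
    - + D ∎
  upper : + D < + c * (- + B + + (suc B ℕ.+ B)) - a
  upper = begin-strict
    + D                                ≡⟨ cancel′ (+ ∣ a ∣) (+ D) ⟩
    (+ ∣ a ∣ + + D) - + ∣ a ∣          <⟨ ℤ.+-monoˡ-< (- + ∣ a ∣) (+<+ (ℕ.n<1+n B)) ⟩
    + suc B - + ∣ a ∣                  ≤⟨ ℤ.+-mono-≤ (scale (suc B)) (ℤ.neg-mono-≤ (i≤∣i∣ a)) ⟩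
    + c * + suc B - a                  ≡⟨ cong (λ x → + c * x - a) (cancel″ (+ B) (+ suc B)) ⟩
    + c * (- + B + + (suc B ℕ.+ B)) - a ∎

⌈_⌉ˢ : (x : Surd) → ∃ (IsCeiling x)
⌈ x ⌉ˢ with ⌊ negate x ⌋ˢ
... | m , m≤-x , -x<m+1 = - m , -x<m+1 ∘ subst (_≤ˢ negate x) eq , subst (_≤ˢ negate x) (sym (ℤ.neg-involutive m)) m≤-x
  where
  eq : - (- m - 1ℤ) ≡ m + 1ℤ
  eq = trans (ℤ.neg-distrib-+ (- m) -1ℤ) (cong (_+ 1ℤ) (ℤ.neg-involutive m))

floor ceiling : Surd → ℤ
floor   x = proj₁ ⌊ x ⌋ˢ
ceiling x = proj₁ ⌈ x ⌉ˢ

r₁ r₂ : ℕ → ℤ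
r₁ n = floor   (surd (+ (3 ℕ.* n) - 1ℤ) Sign.- (12 ℕ.* n ℕ.+ 13) 3) + 1ℤ
r₂ n = ceiling (surd (+ (3 ℕ.* n) - 1ℤ) Sign.+ (12 ℕ.* n ℕ.+ 13) 3) - 1ℤ

-- The integers k with lo ≤ k ≤ hi

integersBetween : (lo hi : ℤ) → List ℤ
integersBetween lo hi = map (λ i → lo + + i) (upTo ∣ 0ℤ ⊔ (hi - lo + 1ℤ) ∣)

-- indices n: the k with r₁ ≤ k ≤ r₂ and k ≡ n (mod 2)

indices : ℕ → List ℤ
indices n = filter (λ k → + 2 ∣? (k - + n)) (integersBetween (r₁ n) (r₂ n))

------------------------------------------------------------------------
-- Laurent series, by their coefficients at all integer exponents

LaurentSeries : Set
LaurentSeries = ℤ → ℤ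

infix  4 _≈ᴸ_
infixl 6 _+ᴸ_
infixr 7 q^_·_

_≈ᴸ_ : LaurentSeries → LaurentSeries → Set
f ≈ᴸ g = ∀ e → f e ≡ g e

_+ᴸ_ : LaurentSeries → LaurentSeries → LaurentSeries
(f +ᴸ g) e = f e + g e

q^_·_ : ℤ → LaurentSeries → LaurentSeries
(q^ d · f) e = f (e - d)

embed : PowerSeries → LaurentSeries
embed f (+ m)    = f m
embed f -[1+ _ ] = 0ℤ

{-# OPTIONS --safe #-}
module Submission where

-- Multiplying the recursion of the elementary symmetric functions in
-- q^t / (1 - q^t)² by (q;q)_N² gives a recursion from which
--   (q;q)_∞³ A_k = q^{k(k+1)/2} + O(q^{(k+1)(k+2)/2})
-- follows by induction, and in the same way
--   (q²;q²)_∞ (q;q²)_∞² C_k = q^{k²} + O(q^{(k+1)²}).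
-- For k = n + 2l and (3n - k)/2 = n - l the product of the two leading terms
-- is q^{(3n²+n)/2 + 3l²+l}, with error O(q^{(3n²+n)/2 + n+1}), and k lies
-- outside [r₁, r₂] exactly when 3l² + l > n, which means
-- (3k - (3n - 1))² = (6l + 1)² ≥ 12n + 13.  Hence, up to this error,
--   Θ₆ (q²;q²)_∞ Σ_k (-1)^{(n-k)/2} A_k C_{(3n-k)/2} = q^{(3n²+n)/2} Σ_l (-1)^l q^{3l²+l},
-- and the last sum is (q²;q²)_∞ by Euler's pentagonal number theorem.

open import Algebra.Bundles using (CommutativeRing)
import Algebra.Properties.Semiring.Exp
open import Data.Nat.Base as ℕ using (ℕ; zero; suc; _∸_; z≤n; s≤s)
import Data.Nat.DivMod as ℕ
import Data.Nat.Divisibility as ℕ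
import Data.Nat.Properties as ℕ
import Data.Nat.Tactic.RingSolver as ℕ-Solver
open import Level using (0ℓ)
open import Relation.Binary.Bundles using (Setoid)
import Relation.Binary.PropositionalEquality as ≡
import Relation.Binary.Reasoning.Setoid as SetoidReasoning
open ≡ using (_≡_)

-- Congruences modulo a multiplicative filtration

-- The induction for the leading terms runs on finite sums over `t ≤ N`, and the right normalising
-- factor there is `(p;p)_{N-k}` rather than `(p;p)_N`, where `p = q^d` with `d = 1` for `A_k` and
-- `d = 2` for `C_k`. Clearing denominators gives a sum over k-element sets `S` of `q^{e(S)}` times
-- squares of `1 - q^{e(t)}` for `t` outside `S`. A correction coming from such a `t` carries at
-- least the exponent of the (k+1)-element set `S ∪ {t}`, so to the claimed precision only the
-- elementary symmetric function of `q, qp, ..., q p^{N-1}` survives. This is the leading power of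
-- `q` times the Gaussian binomial `(p;p)_N / ((p;p)_k (p;p)_{N-k})`, in which `(p;p)_N / (p;p)_k`
-- is 1 to the same precision. The bounds `r₁` and `r₂` are never evaluated. The sum between them is
-- compared with a sum over a larger window symmetric about `n`, where the asymptotics of every term
-- is known, and the extra terms are shown to be negligible.

record Filtration (R : CommutativeRing 0ℓ 0ℓ) : Set₁ where
  open CommutativeRing R
  field
    O      : ℕ → Carrier → Set
    O-resp : ∀ {k x y} → x ≈ y → O k x → O k y
    O-≤    : ∀ {j k x} → j ℕ.≤ k → O k x → O j x
    O-all  : ∀ x → O 0 x
    O-0#   : ∀ k → O k 0#
    O-+    : ∀ {k x y} → O k x → O k y → O k (x + y)
    O-*    : ∀ {j k x y} → O j x → O k y → O (j ℕ.+ k) (x * y)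

module Congruence {R : CommutativeRing 0ℓ 0ℓ} (F : Filtration R) where

  open CommutativeRing R
  open Filtration F
  open import Algebra.Properties.Ring ring using (-1*x≈-x; -0#≈0#; x[y-z]≈xy-xz)
  open import Algebra.Properties.AbelianGroup +-abelianGroup using (⁻¹-anti-homo‿-; ⁻¹-∙-comm; x≈y⇒x∙y⁻¹≈ε)
  open import Algebra.Properties.CommutativeSemigroup +-commutativeSemigroup using (interchange)
  open import Algebra.Properties.Semiring.Exp semiring using (_^_)

  O-multiple : ∀ {k x} y → O k x → O k (y * x)
  O-multiple y Ox = O-* (O-all y) Ox

  O-neg : ∀ {k x} → O k x → O k (- x)
  O-neg {x = x} Ox = O-resp (-1*x≈-x x) (O-multiple (- 1#) Ox)

  O-^ : ∀ {x} k → O 1 x → O k (x ^ k)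
  O-^ zero    Ox = O-all 1#
  O-^ (suc k) Ox = O-* Ox (O-^ k Ox)

  infix 4 _≈[_]_

  _≈[_]_ : Carrier → ℕ → Carrier → Set
  x ≈[ k ] y = O k (x - y)

  ≈⇒≈[] : ∀ {k x y} → x ≈ y → x ≈[ k ] y
  ≈⇒≈[] {k} x≈y = O-resp (sym (x≈y⇒x∙y⁻¹≈ε x≈y)) (O-0# k)

  ≈[]-≤ : ∀ {j k x y} → j ℕ.≤ k → x ≈[ k ] y → x ≈[ j ] y
  ≈[]-≤ = O-≤

  ≈[]-sym : ∀ {k x y} → x ≈[ k ] y → y ≈[ k ] x
  ≈[]-sym {x = x} {y} x≈y = O-resp (⁻¹-anti-homo‿- x y) (O-neg x≈y)

  ≈[]-trans : ∀ {k x y z} → x ≈[ k ] y → y ≈[ k ] z → x ≈[ k ] z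
  ≈[]-trans {x = x} {y} {z} x≈y y≈z = O-resp
    (trans (+-assoc x (- y) (y - z))
      (+-congˡ (trans (sym (+-assoc (- y) y (- z))) (trans (+-congʳ (-‿inverseˡ y)) (+-identityˡ (- z))))))
    (O-+ x≈y y≈z)

  ≈[]-setoid : ℕ → Setoid 0ℓ 0ℓ
  ≈[]-setoid k = record
    { Carrier = Carrier
    ; _≈_ = _≈[ k ]_
    ; isEquivalence = record { refl = ≈⇒≈[] refl ; sym = ≈[]-sym ; trans = ≈[]-trans }
    }

  ≈[]-+-cong : ∀ {k x y u v} → x ≈[ k ] y → u ≈[ k ] v → x + u ≈[ k ] y + v
  ≈[]-+-cong {x = x} {y} {u} {v} x≈y u≈v = O-resp
    (trans (interchange x (- y) u (- v)) (+-congˡ (⁻¹-∙-comm y v)))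
    (O-+ x≈y u≈v)

  -- A factor of order `j` raises the precision by `j`; this is how leading powers of `q` contribute
  -- to the error bounds.
  ≈[]-*-multiple : ∀ {j k x y z} → O j z → x ≈[ k ] y → z * x ≈[ j ℕ.+ k ] z * y
  ≈[]-*-multiple {x = x} {y} {z} Oz x≈y = O-resp (x[y-z]≈xy-xz z x y) (O-* Oz x≈y)

  ≈[]-*-congˡ : ∀ {k x y} z → x ≈[ k ] y → z * x ≈[ k ] z * y
  ≈[]-*-congˡ z = ≈[]-*-multiple (O-all z)

  ≈[]-*-congʳ : ∀ {k x y} z → x ≈[ k ] y → x * z ≈[ k ] y * z
  ≈[]-*-congʳ {x = x} {y} z x≈y =
    ≈[]-trans (≈⇒≈[] (*-comm x z)) (≈[]-trans (≈[]-*-congˡ z x≈y) (≈⇒≈[] (*-comm z y)))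

  ≈[]-*-cong : ∀ {k x y u v} → x ≈[ k ] y → u ≈[ k ] v → x * u ≈[ k ] y * v
  ≈[]-*-cong {y = y} {u} x≈y u≈v = ≈[]-trans (≈[]-*-congʳ u x≈y) (≈[]-*-congˡ y u≈v)

  O⇒≈[]0 : ∀ {k x} → O k x → x ≈[ k ] 0#
  O⇒≈[]0 {x = x} = O-resp (sym (trans (+-congˡ -0#≈0#) (+-identityʳ x)))

  ≈[]-+-O : ∀ {k x y} → O k y → x + y ≈[ k ] x
  ≈[]-+-O {x = x} Oy = ≈[]-trans (≈[]-+-cong (≈⇒≈[] refl) (O⇒≈[]0 Oy)) (≈⇒≈[] (+-identityʳ x))

  ≈[]-^-cong : ∀ {k x y} n → x ≈[ k ] y → x ^ n ≈[ k ] y ^ n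
  ≈[]-^-cong zero    x≈y = ≈⇒≈[] refl
  ≈[]-^-cong (suc n) x≈y = ≈[]-*-cong x≈y (≈[]-^-cong n x≈y)

  [1-x]+x≈1 : ∀ x → (1# - x) + x ≈ 1#
  [1-x]+x≈1 x = trans (+-assoc 1# (- x) x) (trans (+-congˡ (-‿inverseˡ x)) (+-identityʳ 1#))

  [1-x]*y+x*y≈y : ∀ x y → (1# - x) * y + x * y ≈ y
  [1-x]*y+x*y≈y x y = trans (sym (distribʳ y (1# - x) x)) (trans (*-congʳ ([1-x]+x≈1 x)) (*-identityˡ y))

  1-O≈[]1 : ∀ {k x} → O k x → 1# - x ≈[ k ] 1#
  1-O≈[]1 Ox = ≈[]-+-O (O-neg Ox)

  [1-O]^≈[]1 : ∀ {k x} n → O k x → (1# - x) ^ n ≈[ k ] 1#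
  [1-O]^≈[]1 zero    Ox = ≈⇒≈[] refl
  [1-O]^≈[]1 (suc n) Ox = ≈[]-trans (≈[]-*-cong (1-O≈[]1 Ox) ([1-O]^≈[]1 n Ox)) (≈⇒≈[] (*-identityˡ 1#))

-- The leading terms of elementary symmetric functions

-- The least exponent of a sum of k distinct terms of 1, 1 + d, 1 + 2d, ….
minExponent : ℕ → ℕ → ℕ
minExponent d zero    = 0
minExponent d (suc k) = minExponent d k ℕ.+ suc (d ℕ.* k)

module LeadingTerm
  {R : CommutativeRing 0ℓ 0ℓ} (F : Filtration R) where

  open CommutativeRing R hiding (zero)
  open Filtration F
  open Congruence F
  open import Algebra.Properties.Semiring.Exp semiring using (_^_; ^-congˡ; ^-congʳ; ^-homo-*; ^-assocʳ)
  open import Algebra.Solver.Ring.NaturalCoefficients.Default commutativeSemiring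
    using (solve; _:+_; _:*_; _:=_)

  -- In the application `H r` is `(p;p)_r`, `Q N` is `q p^N`, and `P k N` is the k-th elementary
  -- symmetric function of `Q / (1 - Q)^2` over the first `N` values of `Q`, multiplied by the
  -- square of the product of the `1 - Q`.
  module _ {q : Carrier} (Oq : O 1 q) {d : ℕ} {p : Carrier} (p≈q^d : p ≈ q ^ d)
    (H Q : ℕ → Carrier)
    (H-zero : H 0 ≈ 1#)
    (H-suc : ∀ r → H (suc r) ≈ (1# - p * p ^ r) * H r)
    (Q≈q^ : ∀ N → Q N ≈ q ^ suc (d ℕ.* N))
    (P : ℕ → ℕ → Carrier)
    (P-zero : ∀ r → H r * P 0 r ≈[ 1 ] 1#)
    (P-zero-zero : P 0 0 ≈ 1#)
    (P-empty : ∀ k → P (suc k) 0 ≈ 0#)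
    (P-suc : ∀ k N → P (suc k) (suc N) ≈ (1# - Q N) ^ 2 * P (suc k) N + Q N * P k N)
    where

    private
      σ : ℕ → ℕ
      σ = minExponent d

      OQ : ∀ N → O (suc (d ℕ.* N)) (Q N)
      OQ N = O-resp (sym (Q≈q^ N)) (O-^ (suc (d ℕ.* N)) Oq)

      P-vanish : ∀ {k N} → N ℕ.< k → P k N ≈ 0#
      P-vanish {suc k} {zero}  _         = P-empty k
      P-vanish {suc k} {suc N} (s≤s N<k) = begin
        P (suc k) (suc N)                                ≈⟨ P-suc k N ⟩
        (1# - Q N) ^ 2 * P (suc k) N + Q N * P k N
          ≈⟨ +-cong (*-congˡ (P-vanish (ℕ.m<n⇒m<1+n N<k))) (*-congˡ (P-vanish N<k)) ⟩
        (1# - Q N) ^ 2 * 0# + Q N * 0#                   ≈⟨ +-cong (zeroʳ _) (zeroʳ _) ⟩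
        0# + 0#                                          ≈⟨ +-identityʳ 0# ⟩
        0#                                               ∎
        where open SetoidReasoning setoid

      Q*q^σ : ∀ k → Q k * q ^ σ k ≈ q ^ σ (suc k)
      Q*q^σ k = begin
        Q k * q ^ σ k                   ≈⟨ *-congʳ (Q≈q^ k) ⟩
        q ^ suc (d ℕ.* k) * q ^ σ k     ≈⟨ ^-homo-* q (suc (d ℕ.* k)) (σ k) ⟨
        q ^ (suc (d ℕ.* k) ℕ.+ σ k)     ≈⟨ ^-congʳ q (ℕ.+-comm (suc (d ℕ.* k)) (σ k)) ⟩
        q ^ σ (suc k)                   ∎
        where open SetoidReasoning setoid

      P-diagonal : ∀ k → P k k ≈ q ^ σ k
      P-diagonal zero    = P-zero-zero
      P-diagonal (suc k) = begin
        P (suc k) (suc k)                                ≈⟨ P-suc k k ⟩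
        (1# - Q k) ^ 2 * P (suc k) k + Q k * P k k
          ≈⟨ +-cong (trans (*-congˡ (P-vanish (ℕ.n<1+n k))) (zeroʳ _)) (*-congˡ (P-diagonal k)) ⟩
        0# + Q k * q ^ σ k                               ≈⟨ +-identityˡ _ ⟩
        Q k * q ^ σ k                                    ≈⟨ Q*q^σ k ⟩
        q ^ σ (suc k)                                    ∎
        where open SetoidReasoning setoid

      Q-shift : ∀ k r → Q (k ℕ.+ suc r) ≈ (p * p ^ r) * Q k
      Q-shift k r = begin
        Q (k ℕ.+ suc r)                             ≈⟨ Q≈q^ (k ℕ.+ suc r) ⟩
        q ^ suc (d ℕ.* (k ℕ.+ suc r))               ≈⟨ ^-congʳ q (exponent d k r) ⟩
        q ^ (d ℕ.* suc r ℕ.+ suc (d ℕ.* k))         ≈⟨ ^-homo-* q (d ℕ.* suc r) _ ⟩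
        q ^ (d ℕ.* suc r) * q ^ suc (d ℕ.* k)       ≈⟨ *-cong (^-assocʳ q d (suc r)) (Q≈q^ k) ⟨
        (q ^ d) ^ suc r * Q k                       ≈⟨ *-congʳ (^-congˡ (suc r) p≈q^d) ⟨
        (p * p ^ r) * Q k                           ∎
        where
        open SetoidReasoning setoid
        exponent : ∀ d k r → suc (d ℕ.* (k ℕ.+ suc r)) ≡ d ℕ.* suc r ℕ.+ suc (d ℕ.* k)
        exponent = ℕ-Solver.solve-∀

    -- Lexicographic induction on `k` and `r = N - k`: the recursion of `P` leads to `(suc k, r)`
    -- and `(k, suc r)`. Up to the error these contribute the shares `1 - p^(r+1)` and `p^(r+1)` of
    -- one and the same power `q ^ σ (suc k)`, the second because `Q N = p^(r+1) Q k`.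
    leadingTerm : ∀ k r → H r * P k (k ℕ.+ r) ≈[ σ (suc k) ] q ^ σ k
    leadingTerm zero    r       = ≈[]-≤ (s≤s (ℕ.≤-reflexive (ℕ.*-zeroʳ d))) (P-zero r)
    leadingTerm (suc k) zero    = ≈⇒≈[] (begin
      H 0 * P (suc k) (suc k ℕ.+ 0)    ≡⟨ ≡.cong (λ N → H 0 * P (suc k) N) (ℕ.+-identityʳ (suc k)) ⟩
      H 0 * P (suc k) (suc k)          ≈⟨ *-cong H-zero (P-diagonal (suc k)) ⟩
      1# * q ^ σ (suc k)               ≈⟨ *-identityˡ _ ⟩
      q ^ σ (suc k)                    ∎)
      where open SetoidReasoning setoid
    leadingTerm (suc k) (suc r) = begin
      H (suc r) * P (suc k) (suc N)
        ≈⟨ ≈⇒≈[] (*-cong (H-suc r) (P-suc k N)) ⟩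
      (y * H r) * ((1# - Q N) ^ 2 * P (suc k) N + Q N * P k N)
        ≈⟨ ≈⇒≈[] (solve 6 (λ y h u v w x → (y :* h) :* (u :* v :+ w :* x) := (y :* (h :* v)) :* u :+ w :* ((y :* h) :* x)) refl _ _ _ _ _ _) ⟩
      (y * (H r * P (suc k) N)) * (1# - Q N) ^ 2 + Q N * ((y * H r) * P k N)
        ≈⟨ ≈[]-+-cong
             (≈[]-*-congʳ _ (≈[]-*-congˡ y
               (≡.subst (λ M → H r * P (suc k) M ≈[ σ (suc (suc k)) ] q ^ σ (suc k)) (≡.sym (ℕ.+-suc k r)) (leadingTerm (suc k) r))))
             -- The case `k` is known only up to order `σ (suc k)`. The factor `Q N` adds
             -- `suc (d * N)`, which is enough because `suc k ≤ N`.
             (≈[]-≤ bound₁ (≈[]-*-multiple (OQ N)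
               (≈[]-trans (≈⇒≈[] (*-congʳ (sym (H-suc r)))) (leadingTerm k (suc r))))) ⟩
      (y * q ^ σ (suc k)) * (1# - Q N) ^ 2 + Q N * q ^ σ k
        ≈⟨ ≈[]-+-cong (≈[]-≤ bound₂ (≈[]-*-multiple (O-multiple y (O-^ (σ (suc k)) Oq)) ([1-O]^≈[]1 2 (OQ N)))) (≈⇒≈[] refl) ⟩
      (y * q ^ σ (suc k)) * 1# + Q N * q ^ σ k
        ≈⟨ ≈⇒≈[] (+-cong (*-identityʳ _) (trans (*-congʳ (Q-shift k r)) (trans (*-assoc _ _ _) (*-congˡ (Q*q^σ k))))) ⟩
      y * q ^ σ (suc k) + (p * p ^ r) * q ^ σ (suc k)
        ≈⟨ ≈⇒≈[] ([1-x]*y+x*y≈y (p * p ^ r) (q ^ σ (suc k))) ⟩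
      q ^ σ (suc k)                    ∎
      where
      N = k ℕ.+ suc r
      y = 1# - p * p ^ r
      open SetoidReasoning (≈[]-setoid (σ (suc (suc k))))
      dk≤dN : d ℕ.* suc k ℕ.≤ d ℕ.* N
      dk≤dN = ℕ.*-monoʳ-≤ d (≡.subst (suc k ℕ.≤_) (≡.sym (ℕ.+-suc k r)) (s≤s (ℕ.m≤m+n k r)))
      bound₂ : σ (suc (suc k)) ℕ.≤ σ (suc k) ℕ.+ suc (d ℕ.* N)
      bound₂ = ℕ.+-monoʳ-≤ (σ (suc k)) (s≤s dk≤dN)
      bound₁ : σ (suc (suc k)) ℕ.≤ suc (d ℕ.* N) ℕ.+ σ (suc k)
      bound₁ = ≡.subst (σ (suc (suc k)) ℕ.≤_) (ℕ.+-comm (σ (suc k)) _) bound₂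

-- Euler’s pentagonal number theorem

-- pent⁺ l and pent⁻ l are the values of j(3j+1)/2 at j = l and j = -(l+1).
pent⁺ pent⁻ : ℕ → ℕ
pent⁺ zero    = 0
pent⁺ (suc l) = pent⁺ l ℕ.+ suc (suc (3 ℕ.* l))
pent⁻ l       = pent⁺ l ℕ.+ suc (l ℕ.+ l)

module PentagonalNumberTheorem
  {R : CommutativeRing 0ℓ 0ℓ} (F : Filtration R) where

  open CommutativeRing R hiding (zero)
  open Filtration F
  open Congruence F
  open import Algebra.Properties.Ring ring using (-1*x≈-x)
  open import Algebra.Properties.Semiring.Exp semiring using (_^_; ^-congʳ; ^-homo-*)
  open import Algebra.Solver.Ring.NaturalCoefficients.Default commutativeSemiring
    using (solve; _:+_; _:*_; _:=_; con)

  pentagonalSum : Carrier → ℕ → Carrier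
  pentagonalSum p zero    = 1#
  pentagonalSum p (suc l) = pentagonalSum p l + (- 1#) ^ suc l * (p ^ pent⁺ (suc l) + p ^ pent⁻ l)

  module _ {p : Carrier} (Op : O 1 p)
    (H H⁻¹ : ℕ → Carrier)
    (H-zero : H 0 ≈ 1#)
    (H-suc : ∀ r → H (suc r) ≈ (1# - p * p ^ r) * H r)
    (H-inverse : ∀ r → H r * H⁻¹ r ≈ 1#)
    where

    private
      s : ℕ → Carrier
      s = (- 1#) ^_

      s-cancel : ∀ k x → s k * x + s (suc k) * x ≈ 0#
      s-cancel k x = begin
        s k * x + (- 1# * s k) * x    ≈⟨ +-congˡ (trans (*-assoc (- 1#) (s k) x) (-1*x≈-x (s k * x))) ⟩
        s k * x - s k * x             ≈⟨ -‿inverseʳ (s k * x) ⟩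
        0#                            ∎
        where open SetoidReasoning setoid

      H⁻¹-zero : H⁻¹ 0 ≈ 1#
      H⁻¹-zero = trans (sym (*-identityˡ (H⁻¹ 0))) (trans (*-congʳ (sym H-zero)) (H-inverse 0))

      H⁻¹-suc : ∀ r → H⁻¹ (suc r) * (1# - p * p ^ r) ≈ H⁻¹ r
      H⁻¹-suc r = begin
        H⁻¹ (suc r) * y                           ≈⟨ *-identityʳ _ ⟨
        (H⁻¹ (suc r) * y) * 1#                    ≈⟨ *-congˡ (H-inverse r) ⟨
        (H⁻¹ (suc r) * y) * (H r * H⁻¹ r)
          ≈⟨ solve 4 (λ a y h b → (a :* y) :* (h :* b) := ((y :* h) :* a) :* b) refl _ _ _ _ ⟩
        ((y * H r) * H⁻¹ (suc r)) * H⁻¹ r         ≈⟨ *-congʳ (*-congʳ (H-suc r)) ⟨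
        (H (suc r) * H⁻¹ (suc r)) * H⁻¹ r         ≈⟨ *-congʳ (H-inverse (suc r)) ⟩
        1# * H⁻¹ r                                ≈⟨ *-identityˡ _ ⟩
        H⁻¹ r                                     ∎
        where
        open SetoidReasoning setoid
        y = 1# - p * p ^ r

      -- Shanks' finite form of the theorem:
      --   Σ_{|j| ≤ L} (-1)^j p^{j(3j+1)/2} = Σ_{k ≤ L} (-1)^k (p;p)_L / (p;p)_k p^{Lk + k(k+1)/2},
      -- whose terms with k > 0 are O(p^{L+1}).
      exponent : ℕ → ℕ → ℕ
      exponent L zero    = 0
      exponent L (suc k) = exponent L k ℕ.+ (L ℕ.+ suc k)

      exponent-suc : ∀ L k → exponent (suc L) k ≡ exponent L k ℕ.+ k
      exponent-suc L zero    = ≡.refl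
      exponent-suc L (suc k) = ≡.trans (≡.cong (ℕ._+ (suc L ℕ.+ suc k)) (exponent-suc L k)) (rearrange (exponent L k) k L)
        where
        rearrange : ∀ e k L → e ℕ.+ k ℕ.+ (suc L ℕ.+ suc k) ≡ e ℕ.+ (L ℕ.+ suc k) ℕ.+ suc k
        rearrange = ℕ-Solver.solve-∀

      exponent-diagonal : ∀ L → exponent L L ≡ pent⁺ L
      exponent-diagonal zero    = ≡.refl
      exponent-diagonal (suc L) =
        ≡.trans (≡.cong (ℕ._+ (suc L ℕ.+ suc L)) (≡.trans (exponent-suc L L) (≡.cong (ℕ._+ L) (exponent-diagonal L))))
          (rearrange (pent⁺ L) L)
        where
        rearrange : ∀ e L → e ℕ.+ L ℕ.+ (suc L ℕ.+ suc L) ≡ e ℕ.+ suc (suc (3 ℕ.* L))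
        rearrange = ℕ-Solver.solve-∀

      t : ℕ → ℕ → Carrier
      t L k = (H L * H⁻¹ k) * p ^ exponent L k

      t-row : ∀ L k → t (suc L) k ≈ ((1# - p * p ^ L) * p ^ k) * t L k
      t-row L k = begin
        (H (suc L) * H⁻¹ k) * p ^ exponent (suc L) k
          ≈⟨ *-cong (*-congʳ (H-suc L)) (trans (^-congʳ p (exponent-suc L k)) (^-homo-* p (exponent L k) k)) ⟩
        ((y * H L) * H⁻¹ k) * (p ^ exponent L k * p ^ k)
          ≈⟨ solve 5 (λ y h a e x → ((y :* h) :* a) :* (e :* x) := (y :* x) :* ((h :* a) :* e)) refl _ _ _ _ _ ⟩
        (y * p ^ k) * t L k ∎
        where
        open SetoidReasoning setoid
        y = 1# - p * p ^ L

      t-column : ∀ L k → t L (suc k) * (1# - p * p ^ k) ≈ t L k * p ^ suc (L ℕ.+ k)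
      t-column L k = begin
        ((H L * H⁻¹ (suc k)) * p ^ exponent L (suc k)) * y
          ≈⟨ *-congʳ (*-congˡ (trans (^-homo-* p (exponent L k) (L ℕ.+ suc k)) (*-congˡ (^-congʳ p (ℕ.+-suc L k))))) ⟩
        ((H L * H⁻¹ (suc k)) * (p ^ exponent L k * p ^ suc (L ℕ.+ k))) * y
          ≈⟨ solve 5 (λ h a e x y → ((h :* a) :* (e :* x)) :* y := ((h :* (a :* y)) :* e) :* x) refl _ _ _ _ _ ⟩
        ((H L * (H⁻¹ (suc k) * y)) * p ^ exponent L k) * p ^ suc (L ℕ.+ k)
          ≈⟨ *-congʳ (*-congʳ (*-congˡ (H⁻¹-suc k))) ⟩
        t L k * p ^ suc (L ℕ.+ k) ∎
        where
        open SetoidReasoning setoid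
        y = 1# - p * p ^ k

      t-diagonal : ∀ L → t L L ≈ p ^ pent⁺ L
      t-diagonal L = trans (*-cong (H-inverse L) (^-congʳ p (exponent-diagonal L))) (*-identityˡ _)

      -- `difference L k` is `shanksSum L k - shanksSum (suc L) k` written termwise: by `t-row` a
      -- term changes by the factor `1 - (1 - p^(L+1)) p^k = (1 - p^k) + p^(L+1+k)`.
      shanksSum difference : ℕ → ℕ → Carrier
      shanksSum L zero    = t L 0
      shanksSum L (suc k) = shanksSum L k + s (suc k) * t L (suc k)
      difference L zero    = t L 0 * p ^ suc (L ℕ.+ 0)
      difference L (suc k) = difference L k + s (suc k) * (t L (suc k) * ((1# - p ^ suc k) + p ^ suc (L ℕ.+ suc k)))

      -- By `t-column` the part of each new term with factor `1 - p^(k+1)` repeats the previous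
      -- boundary value with opposite sign, so only the last boundary value remains.
      difference-telescopes : ∀ L k → difference L k ≈ s k * (t L k * p ^ suc (L ℕ.+ k))
      difference-telescopes L zero    = sym (*-identityˡ _)
      difference-telescopes L (suc k) = begin
        difference L k + s (suc k) * (t L (suc k) * (y + x))
          ≈⟨ +-cong (difference-telescopes L k) (trans (*-congˡ (distribˡ _ _ _)) (distribˡ _ _ _)) ⟩
        s k * z + (s (suc k) * (t L (suc k) * y) + s (suc k) * (t L (suc k) * x))
          ≈⟨ +-congˡ (+-congʳ (*-congˡ (t-column L k))) ⟩
        s k * z + (s (suc k) * z + s (suc k) * (t L (suc k) * x))
          ≈⟨ +-assoc _ _ _ ⟨
        (s k * z + s (suc k) * z) + s (suc k) * (t L (suc k) * x)
          ≈⟨ +-congʳ (s-cancel k z) ⟩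
        0# + s (suc k) * (t L (suc k) * x)
          ≈⟨ +-identityˡ _ ⟩
        s (suc k) * (t L (suc k) * x) ∎
        where
        open SetoidReasoning setoid
        y = 1# - p ^ suc k
        x = p ^ suc (L ℕ.+ suc k)
        z = t L k * p ^ suc (L ℕ.+ k)

      shanksSum-row : ∀ L k → shanksSum (suc L) k + difference L k ≈ shanksSum L k
      shanksSum-row L zero    = begin
        t (suc L) 0 + t L 0 * p ^ suc (L ℕ.+ 0)
          ≈⟨ +-cong (trans (t-row L 0) (*-congʳ (*-identityʳ _)))
               (trans (*-congˡ (^-congʳ p (≡.cong suc (ℕ.+-identityʳ L)))) (*-comm _ _)) ⟩
        (1# - p * p ^ L) * t L 0 + (p * p ^ L) * t L 0
          ≈⟨ [1-x]*y+x*y≈y _ _ ⟩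
        t L 0 ∎
        where open SetoidReasoning setoid
      shanksSum-row L (suc k) = begin
        (shanksSum (suc L) k + s (suc k) * t (suc L) (suc k)) + (difference L k + s (suc k) * (t L (suc k) * (y + p ^ suc (L ℕ.+ suc k))))
          ≈⟨ +-cong (+-congˡ (*-congˡ (t-row L (suc k)))) (+-congˡ (*-congˡ (*-congˡ (+-congˡ (^-homo-* p (suc L) (suc k)))))) ⟩
        (shanksSum (suc L) k + s (suc k) * ((u * x) * t L (suc k))) + (difference L k + s (suc k) * (t L (suc k) * (y + p ^ suc L * x)))
          ≈⟨ solve 8 (λ a d c u x v y b → (a :+ c :* ((u :* x) :* b)) :+ (d :+ c :* (b :* (y :+ v :* x))) := (a :+ d) :+ c :* (b :* (y :+ (u :+ v) :* x))) refl
               (shanksSum (suc L) k) (difference L k) (s (suc k)) u x (p ^ suc L) y (t L (suc k)) ⟩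
        (shanksSum (suc L) k + difference L k) + s (suc k) * (t L (suc k) * (y + (u + p ^ suc L) * x))
          ≈⟨ +-cong (shanksSum-row L k) (*-congˡ (trans (*-congˡ (trans (+-congˡ (trans (*-congʳ ([1-x]+x≈1 _)) (*-identityˡ x))) ([1-x]+x≈1 x))) (*-identityʳ _))) ⟩
        shanksSum L k + s (suc k) * t L (suc k) ∎
        where
        open SetoidReasoning setoid
        u = 1# - p * p ^ L
        x = p ^ suc k
        y = 1# - p ^ suc k

      -- From `L` to `suc L` the change of row subtracts `s L * p ^ (pent⁺ L + 2L + 1)`, which is
      -- the new summand with exponent `pent⁻ L`, and the added diagonal term is the one with
      -- exponent `pent⁺ (suc L)`.
      shanksSum-diagonal : ∀ L → shanksSum L L ≈ pentagonalSum p L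
      shanksSum-diagonal zero    = trans (*-congʳ (H-inverse 0)) (*-identityʳ 1#)
      shanksSum-diagonal (suc L) = begin
        shanksSum (suc L) L + s (suc L) * t (suc L) (suc L)
          ≈⟨ +-congˡ (*-congˡ (t-diagonal (suc L))) ⟩
        shanksSum (suc L) L + s (suc L) * x⁺
          ≈⟨ +-identityʳ _ ⟨
        (shanksSum (suc L) L + s (suc L) * x⁺) + 0#
          -- This zero supplies `s L * x⁻`, the value of `difference L L`, which turns row `suc L`
          -- back into row `L`.
          ≈⟨ +-congˡ (s-cancel L x⁻) ⟨
        (shanksSum (suc L) L + s (suc L) * x⁺) + (s L * x⁻ + s (suc L) * x⁻)
          ≈⟨ solve 5 (λ a b c d e → (a :+ b :* c) :+ (d :+ b :* e) := (a :+ d) :+ b :* (c :+ e)) refl _ _ _ _ _ ⟩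
        (shanksSum (suc L) L + s L * x⁻) + s (suc L) * (x⁺ + x⁻)
          ≈⟨ +-congʳ (+-congˡ (trans (difference-telescopes L L) (*-congˡ (trans (*-congʳ (t-diagonal L)) (sym (^-homo-* p (pent⁺ L) _)))))) ⟨
        (shanksSum (suc L) L + difference L L) + s (suc L) * (x⁺ + x⁻)
          ≈⟨ +-congʳ (trans (shanksSum-row L L) (shanksSum-diagonal L)) ⟩
        pentagonalSum p L + s (suc L) * (x⁺ + x⁻) ∎
        where
        open SetoidReasoning setoid
        x⁺ = p ^ pent⁺ (suc L)
        x⁻ = p ^ pent⁻ L

      shanksSum-truncated : ∀ L k → shanksSum L k ≈[ suc L ] H L
      shanksSum-truncated L zero    = ≈⇒≈[] (trans (*-identityʳ _) (trans (*-congˡ H⁻¹-zero) (*-identityʳ _)))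
      shanksSum-truncated L (suc k) = ≈[]-trans
        (≈[]-+-O (O-multiple _ (O-multiple _ (O-≤ bound (O-^ (exponent L (suc k)) Op)))))
        (shanksSum-truncated L k)
        where
        bound : suc L ℕ.≤ exponent L (suc k)
        bound = ℕ.≤-trans (ℕ.≤-trans (s≤s (ℕ.m≤m+n L k)) (ℕ.≤-reflexive (≡.sym (ℕ.+-suc L k)))) (ℕ.m≤n+m (L ℕ.+ suc k) (exponent L k))

    pentagonalNumberTheorem : ∀ L → pentagonalSum p L ≈[ suc L ] H L
    pentagonalNumberTheorem L = ≈[]-trans (≈⇒≈[] (sym (shanksSum-diagonal L))) (shanksSum-truncated L L)

-- Fractions and products in commutative rings

module Fractions (R : CommutativeRing 0ℓ 0ℓ) where

  open CommutativeRing R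
  open import Algebra.Properties.Semiring.Exp semiring using (_^_)
  open import Algebra.Solver.Ring.NaturalCoefficients.Default commutativeSemiring
    using (solve; _:+_; _:*_; _:=_; con)
  open SetoidReasoning setoid

  -- Uniqueness of inverses: `u * i` and `j` both invert `d`. This relates the reciprocals of
  -- successive denominators, since `_⁻¹` is given by a recursion on coefficients that does not see
  -- products.
  inverse-factor : ∀ {u d i j} → (u * d) * i ≈ 1# → d * j ≈ 1# → u * i ≈ j
  inverse-factor {u} {d} {i} {j} udi≈1 dj≈1 = begin
    u * i                ≈⟨ *-identityʳ _ ⟨
    (u * i) * 1#         ≈⟨ *-congˡ dj≈1 ⟨
    (u * i) * (d * j)    ≈⟨ solve 4 (λ u d i j → (u :* i) :* (d :* j) := ((u :* d) :* i) :* j) refl u d i j ⟩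
    ((u * d) * i) * j    ≈⟨ *-congʳ udi≈1 ⟩
    1# * j               ≈⟨ *-identityˡ j ⟩
    j                    ∎

  fraction-cancel : ∀ {u d i j w x y} → (u * d) * i ≈ 1# → d * j ≈ 1# → w ≈ x * y → u * (w * i) ≈ x * (y * j)
  fraction-cancel {u} {d} {i} {j} {w} {x} {y} udi≈1 dj≈1 w≈xy = begin
    u * (w * i)          ≈⟨ *-congˡ (*-congʳ w≈xy) ⟩
    u * ((x * y) * i)    ≈⟨ solve 4 (λ u x y i → u :* ((x :* y) :* i) := x :* (y :* (u :* i))) refl u x y i ⟩
    x * (y * (u * i))    ≈⟨ *-congˡ (*-congˡ (inverse-factor udi≈1 dj≈1)) ⟩
    x * (y * j)          ∎

  -- Here `b` and `b′` are the products of the `1 - q^{e(t)}` before and after the factor `u` joins.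
  -- Multiplication by `b ^ 2` turns the recursion of the partial sums into that of `P`.
  clear-denominators : ∀ {u b b′ s s′ w t} → b′ ≈ u * b → u ^ 2 * s′ ≈ u ^ 2 * s + w * t →
                       b′ ^ 2 * s′ ≈ u ^ 2 * (b ^ 2 * s) + w * (b ^ 2 * t)
  clear-denominators {u} {b} {b′} {s} {s′} {w} {t} b′≈ub eq = begin
    b′ ^ 2 * s′                                ≈⟨ *-congʳ (*-cong b′≈ub (*-congʳ b′≈ub)) ⟩
    (u * b) ^ 2 * s′
      ≈⟨ solve 3 (λ u b s → (u :* b) :* ((u :* b) :* con 1) :* s := b :* (b :* con 1) :* (u :* (u :* con 1) :* s)) refl u b s′ ⟩
    b ^ 2 * (u ^ 2 * s′)                       ≈⟨ *-congˡ eq ⟩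
    b ^ 2 * (u ^ 2 * s + w * t)
      ≈⟨ solve 5 (λ c v s w t → c :* (v :* s :+ w :* t) := v :* (c :* s) :+ w :* (c :* t)) refl (b ^ 2) (u ^ 2) s w t ⟩
    u ^ 2 * (b ^ 2 * s) + w * (b ^ 2 * t)      ∎

module Products {R : CommutativeRing 0ℓ 0ℓ} (F : Filtration R) where

  open CommutativeRing R hiding (zero)
  open Filtration F
  open Congruence F
  open import Algebra.Properties.Semiring.Exp semiring using (_^_; ^-homo-*; ^-assocʳ)
  open import Algebra.Solver.Ring.NaturalCoefficients.Default commutativeSemiring
    using (solve; _:+_; _:*_; _:=_; con)

  O-resp-≈[] : ∀ {k x y} → x ≈[ k ] y → O k y → O k x
  O-resp-≈[] {x = x} {y} x≈y Oy = O-resp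
    (trans (+-assoc x (- y) y) (trans (+-congˡ (-‿inverseˡ y)) (+-identityʳ x)))
    (O-+ x≈y Oy)

  -- The error of `y` is multiplied by `x`, which has order `a` because `a ≤ a′`; the error of `x`
  -- is then multiplied by `q ^ b`. Each precision is thus raised by the leading exponent of the
  -- other factor.
  ≈[]-*-leading : ∀ {q a a′ b b′ k x y} → O 1 q → a ℕ.≤ a′ → k ℕ.≤ a′ ℕ.+ b → k ℕ.≤ a ℕ.+ b′ →
                  x ≈[ a′ ] q ^ a → y ≈[ b′ ] q ^ b → x * y ≈[ k ] q ^ (a ℕ.+ b)
  ≈[]-*-leading {q} {a} {a′} {b} {b′} {k} {x} {y} Oq a≤a′ k≤a′+b k≤a+b′ x≈q^a y≈q^b = begin
    x * y            ≈⟨ ≈[]-≤ k≤a+b′ (≈[]-*-multiple (O-resp-≈[] (≈[]-≤ a≤a′ x≈q^a) (O-^ a Oq)) y≈q^b) ⟩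
    x * q ^ b        ≈⟨ ≈⇒≈[] (*-comm x (q ^ b)) ⟩
    q ^ b * x        ≈⟨ ≈[]-≤ (≡.subst (k ℕ.≤_) (ℕ.+-comm a′ b) k≤a′+b) (≈[]-*-multiple (O-^ b Oq) x≈q^a) ⟩
    q ^ b * q ^ a    ≈⟨ ≈⇒≈[] (*-comm (q ^ b) (q ^ a)) ⟩
    q ^ a * q ^ b    ≈⟨ ≈⇒≈[] (^-homo-* q a b) ⟨
    q ^ (a ℕ.+ b)    ∎
    where open SetoidReasoning (≈[]-setoid k)

  ≈[]-divide : ∀ {k u i x y} → u * i ≈ 1# → u * x ≈[ k ] y → x ≈[ k ] i * y
  ≈[]-divide {k} {u} {i} {x} {y} ui≈1 ux≈y = begin
    x              ≈⟨ ≈⇒≈[] (*-identityˡ x) ⟨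
    1# * x         ≈⟨ ≈⇒≈[] (*-congʳ ui≈1) ⟨
    (u * i) * x    ≈⟨ ≈⇒≈[] (solve 3 (λ u i x → (u :* i) :* x := i :* (u :* x)) refl u i x) ⟩
    i * (u * x)    ≈⟨ ≈[]-*-congˡ i ux≈y ⟩
    i * y          ∎
    where open SetoidReasoning (≈[]-setoid k)

  ≈[]-cancel : ∀ {k θ h θ⁻¹ h⁻¹ x y} → θ * θ⁻¹ ≈ 1# → h * h⁻¹ ≈ 1# → (θ * h) * x ≈[ k ] y * h → x ≈[ k ] y * θ⁻¹
  ≈[]-cancel {k} {θ} {h} {θ⁻¹} {h⁻¹} {x} {y} θθ⁻¹≈1 hh⁻¹≈1 eq = begin
    x                         ≈⟨ ≈[]-divide (trans (solve 4 (λ t h t′ h′ → (t :* h) :* (t′ :* h′) := (t :* t′) :* (h :* h′)) refl θ h θ⁻¹ h⁻¹)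
                                   (trans (*-cong θθ⁻¹≈1 hh⁻¹≈1) (*-identityˡ 1#))) eq ⟩
    (θ⁻¹ * h⁻¹) * (y * h)     ≈⟨ ≈⇒≈[] (solve 4 (λ t h′ y h → (t :* h′) :* (y :* h) := (y :* t) :* (h :* h′)) refl θ⁻¹ h⁻¹ y h) ⟩
    (y * θ⁻¹) * (h * h⁻¹)     ≈⟨ ≈⇒≈[] (trans (*-congˡ hh⁻¹≈1) (*-identityʳ (y * θ⁻¹))) ⟩
    y * θ⁻¹                   ∎
    where open SetoidReasoning (≈[]-setoid k)

  -- The sum of f over {0}, {±1}, …, {±l}, where f⁺ l = f l and f⁻ l = f (- (l + 1)).
  symmetricSum : (f⁺ f⁻ : ℕ → Carrier) → ℕ → Carrier
  symmetricSum f⁺ f⁻ zero    = f⁺ 0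
  symmetricSum f⁺ f⁻ (suc l) = symmetricSum f⁺ f⁻ l + (f⁺ (suc l) + f⁻ l)

  open PentagonalNumberTheorem F using (pentagonalSum)

  -- The doubled exponents are absorbed by taking `q ^ 2` as the variable of Euler's sum.
  symmetricSum≈pentagonalSum : ∀ {k q M r f⁺ f⁻} →
    (∀ l → r * f⁺ l ≈[ k ] (- 1#) ^ l * q ^ (M ℕ.+ 2 ℕ.* pent⁺ l)) →
    (∀ l → r * f⁻ l ≈[ k ] (- 1#) ^ suc l * q ^ (M ℕ.+ 2 ℕ.* pent⁻ l)) →
    ∀ l → r * symmetricSum f⁺ f⁻ l ≈[ k ] q ^ M * pentagonalSum (q ^ 2) l
  symmetricSum≈pentagonalSum {k} {q} {M} {r} {f⁺} {f⁻} r*f⁺ r*f⁻ = go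
    where
    open SetoidReasoning (≈[]-setoid k)
    q^[M+2e] : ∀ e → q ^ (M ℕ.+ 2 ℕ.* e) ≈ q ^ M * (q ^ 2) ^ e
    q^[M+2e] e = trans (^-homo-* q M (2 ℕ.* e)) (*-congˡ (sym (^-assocʳ q 2 e)))
    go : ∀ l → r * symmetricSum f⁺ f⁻ l ≈[ k ] q ^ M * pentagonalSum (q ^ 2) l
    go zero    = ≈[]-trans (r*f⁺ 0) (≈⇒≈[] (trans (*-identityˡ _) (q^[M+2e] 0)))
    go (suc l) = begin
      r * (symmetricSum f⁺ f⁻ l + (f⁺ (suc l) + f⁻ l))
        ≈⟨ ≈⇒≈[] (trans (distribˡ r _ _) (+-congˡ (distribˡ r _ _))) ⟩
      r * symmetricSum f⁺ f⁻ l + (r * f⁺ (suc l) + r * f⁻ l)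
        ≈⟨ ≈[]-+-cong (go l) (≈[]-+-cong
             (≈[]-trans (r*f⁺ (suc l)) (≈⇒≈[] (*-congˡ (q^[M+2e] (pent⁺ (suc l))))))
             (≈[]-trans (r*f⁻ l) (≈⇒≈[] (*-congˡ (q^[M+2e] (pent⁻ l)))))) ⟩
      q ^ M * pentagonalSum (q ^ 2) l + (s * (q ^ M * x⁺) + s * (q ^ M * x⁻))
        ≈⟨ ≈⇒≈[] (solve 5 (λ m p s x y → m :* p :+ (s :* (m :* x) :+ s :* (m :* y)) := m :* (p :+ s :* (x :+ y))) refl
             (q ^ M) (pentagonalSum (q ^ 2) l) s x⁺ x⁻) ⟩
      q ^ M * pentagonalSum (q ^ 2) (suc l) ∎
      where
      s = (- 1#) ^ suc l
      x⁺ = (q ^ 2) ^ pent⁺ (suc l)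
      x⁻ = (q ^ 2) ^ pent⁻ l

  -- With `f = (q;q)_∞`, `g = (q;q²)_∞` and `h = (q²;q²)_∞`, the product `θ * h` consists exactly of
  -- the normalising factors of both series, `f * f ^ 2` and `h * g ^ 2`.
  leading-product : ∀ {q a a′ b b′ k θ h f g x y} → O 1 q → a ℕ.≤ a′ → k ℕ.≤ a′ ℕ.+ b → k ℕ.≤ a ℕ.+ b′ →
                    θ ≈ f ^ 3 * g ^ 2 → f * (f ^ 2 * x) ≈[ a′ ] q ^ a → h * (g ^ 2 * y) ≈[ b′ ] q ^ b →
                    (θ * h) * (x * y) ≈[ k ] q ^ (a ℕ.+ b)
  leading-product {θ = θ} {h} {f} {g} {x} {y} Oq a≤a′ k≤a′+b k≤a+b′ θ≈ x≈ y≈ =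
    ≈[]-trans (≈⇒≈[] (trans (*-congʳ (*-congʳ θ≈)) (regroup f g h x y))) (≈[]-*-leading Oq a≤a′ k≤a′+b k≤a+b′ x≈ y≈)
    where
    regroup : ∀ f g h x y → ((f ^ 3 * g ^ 2) * h) * (x * y) ≈ (f * (f ^ 2 * x)) * (h * (g ^ 2 * y))
    regroup = solve 5
      (λ f g h x y → ((f :* (f :* (f :* con 1)) :* (g :* (g :* con 1))) :* h) :* (x :* y)
                  := (f :* (f :* (f :* con 1) :* x)) :* (h :* (g :* (g :* con 1) :* y))) refl

  scale-sign : ∀ {k r s f x} → r * f ≈[ k ] x → r * (s * f) ≈[ k ] s * x
  scale-sign {k} {r} {s} {f} rf≈x =
    ≈[]-trans (≈⇒≈[] (solve 3 (λ r s f → r :* (s :* f) := s :* (r :* f)) refl r s f)) (≈[]-*-congˡ s rf≈x)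

  zero-asymptotics : ∀ {k r x y} → x ≈ 0# → O k y → r * x ≈[ k ] y
  zero-asymptotics {r = r} x≈0 Oy =
    ≈[]-trans (≈⇒≈[] (trans (*-congˡ x≈0) (zeroʳ r))) (≈[]-sym (O⇒≈[]0 Oy))

  O-cancel : ∀ {k θ h θ⁻¹ h⁻¹ x} → θ * θ⁻¹ ≈ 1# → h * h⁻¹ ≈ 1# → O k ((θ * h) * x) → O k x
  O-cancel {h = h} {θ⁻¹} θθ⁻¹≈1 hh⁻¹≈1 Oθhx = O-resp-≈[]
    (≈[]-cancel θθ⁻¹≈1 hh⁻¹≈1 (≈[]-trans (O⇒≈[]0 Oθhx) (≈⇒≈[] (sym (zeroˡ h)))))
    (O-resp (sym (zeroˡ θ⁻¹)) (O-0# _))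

open import Defs
open import Data.Fin.Base using (Fin; toℕ)
open import Data.Integer.Base as ℤ
  using (ℤ; +_; -[1+_]; _+_; _*_; -_; _-_; _/_; _^_; _⊔_; ∣_∣; _≤_; _<_; 0ℤ; 1ℤ; -1ℤ)
open import Data.Integer.Divisibility.Signed using (_∣_; _∣?_; divides; ∣m+n∣m⇒∣n; ∣⇒∣ᵤ)
import Data.Integer.Properties as ℤ
open import Data.Integer.Tactic.RingSolver using (solve-∀)
open import Data.List.Base using ([]; _∷_; map; filter; upTo; applyUpTo)
open import Data.List.Relation.Unary.All as All using (All; []; _∷_)
import Data.List.Relation.Unary.All.Properties as All
open import Data.Nat.ListAction using (sum)
open import Data.Product.Base using (∃; ∃₂; _×_; _,_; proj₁; proj₂)
open import Data.Sign.Base as Sign using (Sign)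
open import Data.Sum.Base using (_⊎_; inj₁; inj₂)
open import Function.Base using (id; _∘_)
open ≡ using (refl; sym; trans; cong; cong₂; subst; module ≡-Reasoning)
open import Relation.Nullary using (¬_; Dec; yes; no; contradiction)
open import Algebra.Properties.Semiring.Sum ℤ.+-*-semiring
  using (sum-cong-≗; ∑-distrib-+; *-distribˡ-sum)

-- The ring of formal power series

tail : PowerSeries → PowerSeries
tail f m = f (suc m)

*ₛ-cong : ∀ {f g h k} → f ≈ₛ g → h ≈ₛ k → f *ₛ h ≈ₛ g *ₛ k
*ₛ-cong f≈g h≈k m = sum-cong-≗ λ (i : Fin (suc m)) → cong₂ _*_ (f≈g (toℕ i)) (h≈k (m ∸ toℕ i))

*ₛ-distribʳ : ∀ h f g → (f +ₛ g) *ₛ h ≈ₛ f *ₛ h +ₛ g *ₛ h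
*ₛ-distribʳ h f g m = trans
  (sum-cong-≗ λ (i : Fin (suc m)) → ℤ.*-distribʳ-+ (h (m ∸ toℕ i)) (f (toℕ i)) (g (toℕ i)))
  (∑-distrib-+ (λ (i : Fin (suc m)) → f (toℕ i) * h (m ∸ toℕ i)) (λ i → g (toℕ i) * h (m ∸ toℕ i)))

·ₛ-*ₛ-assoc : ∀ c f g → (c ·ₛ f) *ₛ g ≈ₛ c ·ₛ (f *ₛ g)
·ₛ-*ₛ-assoc c f g m = trans
  (sum-cong-≗ λ (i : Fin (suc m)) → ℤ.*-assoc c (f (toℕ i)) (g (m ∸ toℕ i)))
  (sym (*-distribˡ-sum c (λ (i : Fin (suc m)) → f (toℕ i) * g (m ∸ toℕ i))))

-- Induction on the coefficient through the rule `tail (f *ₛ g) = f 0 ·ₛ tail g +ₛ tail f *ₛ g`,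
-- which holds by computation.
*ₛ-assoc : ∀ f g h → (f *ₛ g) *ₛ h ≈ₛ f *ₛ (g *ₛ h)
*ₛ-assoc f g h zero    = assoc₀ (f 0) (g 0) (h 0)
  where
  assoc₀ : ∀ a b c → (a * b + 0ℤ) * c + 0ℤ ≡ a * (b * c + 0ℤ) + 0ℤ
  assoc₀ = solve-∀
*ₛ-assoc f g h (suc m) = begin
  (f *ₛ g) 0 * h (suc m) + (tail (f *ₛ g) *ₛ h) m
    ≡⟨ cong (λ x → (f *ₛ g) 0 * h (suc m) + x) (*ₛ-distribʳ h (f 0 ·ₛ tail g) (tail f *ₛ g) m) ⟩
  (f *ₛ g) 0 * h (suc m) + (((f 0 ·ₛ tail g) *ₛ h) m + ((tail f *ₛ g) *ₛ h) m)
    ≡⟨ cong₂ (λ x y → (f *ₛ g) 0 * h (suc m) + (x + y)) (·ₛ-*ₛ-assoc (f 0) (tail g) h m) (*ₛ-assoc (tail f) g h m) ⟩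
  (f 0 * g 0 + 0ℤ) * h (suc m) + (f 0 * (tail g *ₛ h) m + (tail f *ₛ (g *ₛ h)) m)
    ≡⟨ regroup (f 0) (g 0) (h (suc m)) _ _ ⟩
  f 0 * (g 0 * h (suc m) + (tail g *ₛ h) m) + (tail f *ₛ (g *ₛ h)) m ∎
  where
  open ≡-Reasoning
  regroup : ∀ a b c x y → (a * b + 0ℤ) * c + (a * x + y) ≡ a * (b * c + x) + y
  regroup = solve-∀

-- The Cauchy product computes by splitting off its first summand; splitting off the last one
-- instead makes commutativity an induction.
*ₛ-last : ∀ f g m → (f *ₛ g) (suc m) ≡ f (suc m) * g 0 + (f *ₛ tail g) m
*ₛ-last f g zero    = swap (f 0) (f 1) (g 0) (g 1)
  where
  swap : ∀ a b c d → a * d + (b * c + 0ℤ) ≡ b * c + (a * d + 0ℤ)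
  swap = solve-∀
*ₛ-last f g (suc m) = trans
  (cong (λ x → f 0 * g (suc (suc m)) + x) (*ₛ-last (tail f) g m))
  (swap (f 0 * g (suc (suc m))) (f (suc (suc m)) * g 0) ((tail f *ₛ tail g) m))
  where
  swap : ∀ a b c → a + (b + c) ≡ b + (a + c)
  swap = solve-∀

*ₛ-comm : ∀ f g → f *ₛ g ≈ₛ g *ₛ f
*ₛ-comm f g zero    = cong (_+ 0ℤ) (ℤ.*-comm (f 0) (g 0))
*ₛ-comm f g (suc m) = sym (trans (*ₛ-last g f m)
  (cong₂ _+_ (ℤ.*-comm (g (suc m)) (f 0)) (*ₛ-comm g (tail f) m)))

*ₛ-identityˡ : ∀ f → 1ₛ *ₛ f ≈ₛ f
*ₛ-identityˡ f zero    = trans (ℤ.+-identityʳ _) (ℤ.*-identityˡ (f 0))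
*ₛ-identityˡ f (suc m) = trans
  (cong₂ _+_ (ℤ.*-identityˡ (f (suc m))) (sumᶠ-zero (λ (i : Fin (suc m)) → 0ℤ * f (m ∸ toℕ i)) λ i → ℤ.*-zeroˡ (f (m ∸ toℕ i))))
  (ℤ.+-identityʳ (f (suc m)))

powerSeriesRing : CommutativeRing 0ℓ 0ℓ
powerSeriesRing = record
  { Carrier = PowerSeries
  ; _≈_ = _≈ₛ_
  ; _+_ = _+ₛ_
  ; _*_ = _*ₛ_
  ; -_ = -ₛ_
  ; 0# = 0ₛ
  ; 1# = 1ₛ
  ; isCommutativeRing = record
    { isRing = record
      { +-isAbelianGroup = record
        { isGroup = record
          { isMonoid = record
            { isSemigroup = record
              { isMagma = record
                { isEquivalence = record
                  { refl = λ _ → refl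
                  ; sym = λ f≈g m → sym (f≈g m)
                  ; trans = λ f≈g g≈h m → trans (f≈g m) (g≈h m)
                  }
                ; ∙-cong = λ f≈g h≈k m → cong₂ _+_ (f≈g m) (h≈k m)
                }
              ; assoc = λ f g h m → ℤ.+-assoc (f m) (g m) (h m)
              }
            ; identity = (λ f m → ℤ.+-identityˡ (f m)) , (λ f m → ℤ.+-identityʳ (f m))
            }
          ; inverse = (λ f m → ℤ.+-inverseˡ (f m)) , (λ f m → ℤ.+-inverseʳ (f m))
          ; ⁻¹-cong = λ f≈g m → cong -_ (f≈g m)
          }
        ; comm = λ f g m → ℤ.+-comm (f m) (g m)
        }
      ; *-cong = *ₛ-cong
      ; *-assoc = *ₛ-assoc
      ; *-identity = *ₛ-identityˡ , λ f m → trans (*ₛ-comm f 1ₛ m) (*ₛ-identityˡ f m)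
      ; distrib =
          (λ f g h m → trans (*ₛ-comm f (g +ₛ h) m)
            (trans (*ₛ-distribʳ f g h m) (cong₂ _+_ (*ₛ-comm g f m) (*ₛ-comm h f m))))
        , *ₛ-distribʳ
      }
    ; *-comm = *ₛ-comm
    }
  }

q-adic : Filtration powerSeriesRing
q-adic = record
  { O      = O[q^_]
  ; O-resp = λ f≈g Of m m<k → trans (sym (f≈g m)) (Of m m<k)
  ; O-≤    = λ j≤k Of m m<j → Of m (ℕ.<-≤-trans m<j j≤k)
  ; O-all  = λ _ _ ()
  ; O-0#   = λ _ _ _ → refl
  ; O-+    = λ Of Og m m<k → cong₂ _+_ (Of m m<k) (Og m m<k)
  ; O-*    = λ {_} {_} {f} {g} → *ₛ-order f g
  }

-- The leading terms of A_k and C_k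

module PS = CommutativeRing powerSeriesRing
open Congruence q-adic
open import Algebra.Properties.Semiring.Exp PS.semiring using (^-congʳ; ^-homo-*; ^-assocʳ; ^-congˡ)
open Fractions powerSeriesRing
open LeadingTerm q-adic
module PSReasoning = SetoidReasoning PS.setoid

sumOver-scale : ∀ {I : Set} {u v} {f g : I → PowerSeries} {is} →
                All (λ i → u *ₛ f i ≈ₛ v *ₛ g i) is → u *ₛ sumOver is f ≈ₛ v *ₛ sumOver is g
sumOver-scale {u = u} {v} []        = PS.trans {u *ₛ 0ₛ} {0ₛ} {v *ₛ 0ₛ} (PS.zeroʳ u) (PS.sym {v *ₛ 0ₛ} {0ₛ} (PS.zeroʳ v))
sumOver-scale {u = u} {v} {f} {g} {i ∷ is} (eq ∷ eqs) = begin
  u *ₛ (f i +ₛ sumOver is f)          ≈⟨ PS.distribˡ u (f i) (sumOver is f) ⟩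
  u *ₛ f i +ₛ u *ₛ sumOver is f       ≈⟨ (λ m → cong₂ _+_ (eq m) (sumOver-scale {u = u} {v} eqs m)) ⟩
  v *ₛ g i +ₛ v *ₛ sumOver is g       ≈⟨ PS.distribˡ v (g i) (sumOver is g) ⟨
  v *ₛ (g i +ₛ sumOver is g)          ∎
  where open PSReasoning

sumOver-map : ∀ {I J : Set} (h : I → J) is f → sumOver (map h is) f ≡ sumOver is (f ∘ h)
sumOver-map h []       f = refl
sumOver-map h (i ∷ is) f = cong (f (h i) +ₛ_) (sumOver-map h is f)

module _ (e : ℕ → ℕ) (0<e : ∀ t → 0 ℕ.< e (suc t)) where

  increasingTuples-positive : ∀ k N → All (All (λ t → 0 ℕ.< e t)) (increasingTuples k N)
  increasingTuples-positive zero    N       = [] ∷ []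
  increasingTuples-positive (suc k) zero    = []
  increasingTuples-positive (suc k) (suc N) = All.++⁺ (increasingTuples-positive (suc k) N)
    (All.map⁺ (All.map (0<e N ∷_) (increasingTuples-positive k N)))

  summand-∷ : ∀ t {ts} → 0 ℕ.< e t → All (λ t → 0 ℕ.< e t) ts →
              (1ₛ -ₛ q ^ₛ e t) ^ₛ 2 *ₛ summand e (t ∷ ts) ≈ₛ q ^ₛ e t *ₛ summand e ts
  summand-∷ t {ts} 0<et 0<ets = fraction-cancel
    {u = (1ₛ -ₛ q ^ₛ e t) ^ₛ 2} {d = denominator e ts} {i = denominator e (t ∷ ts) ⁻¹} {j = denominator e ts ⁻¹}
    {w = q ^ₛ sum (map e (t ∷ ts))} {x = q ^ₛ e t} {y = q ^ₛ sum (map e ts)}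
    (*ₛ-inverseʳ (denominator e (t ∷ ts)) (denominator-constant e (t ∷ ts) (0<et ∷ 0<ets)))
    (*ₛ-inverseʳ (denominator e ts) (denominator-constant e ts 0<ets))
    (^-homo-* q (e t) (sum (map e ts)))

  -- The tuples are split by whether their largest entry is `suc N`. Multiplying by `u` keeps the
  -- recursion free of division.
  partialSum-suc : ∀ k N → let u = (1ₛ -ₛ q ^ₛ e (suc N)) ^ₛ 2 in
    u *ₛ partialSum e (suc k) (suc N) ≈ₛ u *ₛ partialSum e (suc k) N +ₛ q ^ₛ e (suc N) *ₛ partialSum e k N
  partialSum-suc k N = begin
    u *ₛ partialSum e (suc k) (suc N)
      ≈⟨ PS.*-congˡ {u} {partialSum e (suc k) (suc N)} {partialSum e (suc k) N +ₛ new} (sumOver-++ (increasingTuples (suc k) N) _ (summand e)) ⟩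
    u *ₛ (partialSum e (suc k) N +ₛ new)
      ≈⟨ PS.distribˡ u (partialSum e (suc k) N) new ⟩
    u *ₛ partialSum e (suc k) N +ₛ u *ₛ new
      ≈⟨ PS.+-congˡ {u *ₛ partialSum e (suc k) N} {u *ₛ new} {q ^ₛ e (suc N) *ₛ partialSum e k N} new-scaled ⟩
    u *ₛ partialSum e (suc k) N +ₛ q ^ₛ e (suc N) *ₛ partialSum e k N ∎
    where
    open PSReasoning
    u = (1ₛ -ₛ q ^ₛ e (suc N)) ^ₛ 2
    new = sumOver (map (suc N ∷_) (increasingTuples k N)) (summand e)
    new-scaled : u *ₛ new ≈ₛ q ^ₛ e (suc N) *ₛ partialSum e k N
    new-scaled rewrite sumOver-map (suc N ∷_) (increasingTuples k N) (summand e) =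
      sumOver-scale {u = u} {q ^ₛ e (suc N)} (All.map (summand-∷ (suc N) (0<e N)) (increasingTuples-positive k N))

≗⇒≈[] : ∀ {k f g} → (∀ m → m ℕ.< k → f m ≡ g m) → f ≈[ k ] g
≗⇒≈[] {f = f} {g} f≗g m m<k = ℤ.i≡j⇒i-j≡0 (f≗g m m<k)

≈[]⇒≗ : ∀ {k f g} → f ≈[ k ] g → ∀ m → m ℕ.< k → f m ≡ g m
≈[]⇒≗ {f = f} {g} f≈g m m<k = ℤ.i-j≡0⇒i≡j (f m) (g m) (f≈g m m<k)

constant-1⇒≈[1] : ∀ {f} → f 0 ≡ 1ℤ → f ≈[ 1 ] 1ₛ
constant-1⇒≈[1] {f} f₀ zero    _        = ℤ.i≡j⇒i-j≡0 f₀
constant-1⇒≈[1] {f} f₀ (suc _) (s≤s ())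

Oq : O[q^ 1 ] q
Oq zero    _        = refl
Oq (suc _) (s≤s ())

pochhammer-constant : ∀ a p N → a 0 ≡ 0ℤ → pochhammer a p N 0 ≡ 1ℤ
pochhammer-constant a p zero    a₀ = refl
pochhammer-constant a p (suc N) a₀ = *ₛ-constant-1 (1ₛ -ₛ a *ₛ p ^ₛ N) (pochhammer a p N)
  (cong (λ x → 1ℤ - x) (trans (*ₛ-constant a (p ^ₛ N)) (cong (λ x → x * (p ^ₛ N) 0) a₀)))
  (pochhammer-constant a p N a₀)

lim-≈[] : ∀ {k N} s c → (∀ m → m ℕ.< k → Convergent.modulus c m ℕ.≤ N) → lim s c ≈[ k ] s N
lim-≈[] s c modulus≤N = ≗⇒≈[] λ m m<k → sym (Convergent.stable c m (modulus≤N m m<k))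

⦅⦆∞-≈[] : ∀ {k N} a p {p₀} → k ℕ.≤ N → ⦅ a ⨾ p ⦆∞ {p₀} ≈[ k ] pochhammer a p N
⦅⦆∞-≈[] a p {p₀} k≤N = lim-≈[] (pochhammer a p) (pochhammer-convergent a p p₀) λ m m<k → ℕ.≤-trans m<k k≤N

-- Both series are treated at once, through exponents in the progression 1, 1 + d, 1 + 2d, ...:
-- `d = 1` with `e = id` gives `A`, and `d = 2` with `e = odd` gives `C`.
module _ {d : ℕ} (p : PowerSeries) (p₀ : p 0 ≡ 0ℤ) (p≈q^d : p ≈ₛ q ^ₛ d)
  (e : ℕ → ℕ) (t≤et : ∀ t → t ℕ.≤ e t) (e-suc : ∀ N → e (suc N) ≡ suc (d ℕ.* N)) where

  S : ℕ → PowerSeries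
  S k = lim (partialSum e k) (partialSum-convergent e t≤et k)

  private
    H B : ℕ → PowerSeries
    H = pochhammer p p
    B = pochhammer q p

    P : ℕ → ℕ → PowerSeries
    P k N = B N ^ₛ 2 *ₛ partialSum e k N

    Q : ℕ → PowerSeries
    Q N = q *ₛ p ^ₛ N

    Q≈q^ : ∀ N → Q N ≈ₛ q ^ₛ suc (d ℕ.* N)
    Q≈q^ N = PS.*-congˡ {q} {p ^ₛ N} {q ^ₛ (d ℕ.* N)}
      (PS.trans {p ^ₛ N} {(q ^ₛ d) ^ₛ N} {q ^ₛ (d ℕ.* N)} (^-congˡ N {p} {q ^ₛ d} p≈q^d) (^-assocʳ q d N))

    q^e≈Q : ∀ N → q ^ₛ e (suc N) ≈ₛ Q N
    q^e≈Q N = PS.trans {q ^ₛ e (suc N)} {q ^ₛ suc (d ℕ.* N)} {Q N}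
      (^-congʳ q (e-suc N)) (PS.sym {Q N} {q ^ₛ suc (d ℕ.* N)} (Q≈q^ N))

    P-suc : ∀ k N → P (suc k) (suc N) ≈ₛ (1ₛ -ₛ Q N) ^ₛ 2 *ₛ P (suc k) N +ₛ Q N *ₛ P k N
    P-suc k N = PS.trans {P (suc k) (suc N)} {u ^ₛ 2 *ₛ P (suc k) N +ₛ w *ₛ P k N}
      (clear-denominators {u = u} {b = B N} {b′ = B (suc N)}
        {s = partialSum e (suc k) N} {s′ = partialSum e (suc k) (suc N)} {w = w} {t = partialSum e k N}
        (PS.*-congʳ {B N} {1ₛ -ₛ Q N} {u} (PS.sym {u} {1ₛ -ₛ Q N} u≈))
        (partialSum-suc e (λ t → ℕ.≤-trans (s≤s z≤n) (t≤et (suc t))) k N))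
      (PS.+-cong {u ^ₛ 2 *ₛ P (suc k) N} {(1ₛ -ₛ Q N) ^ₛ 2 *ₛ P (suc k) N} {w *ₛ P k N} {Q N *ₛ P k N}
        (PS.*-congʳ {P (suc k) N} {u ^ₛ 2} {(1ₛ -ₛ Q N) ^ₛ 2} (^-congˡ 2 {u} {1ₛ -ₛ Q N} u≈))
        (PS.*-congʳ {P k N} {w} {Q N} (q^e≈Q N)))
      where
      w = q ^ₛ e (suc N)
      u = 1ₛ -ₛ w
      u≈ : u ≈ₛ 1ₛ -ₛ Q N
      u≈ m = cong (λ x → 1ₛ m - x) (q^e≈Q N m)

    P-zero-constant : ∀ N → P 0 N 0 ≡ 1ℤ
    P-zero-constant N = *ₛ-constant-1 (B N ^ₛ 2) (partialSum e 0 N) (^ₛ-constant-1 (B N) 2 (pochhammer-constant q p N refl)) refl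

    P-zero-zero : P 0 0 ≈ₛ 1ₛ
    P-zero-zero = begin
      1ₛ ^ₛ 2 *ₛ partialSum e 0 0    ≈⟨ PS.*-cong {1ₛ ^ₛ 2} {1ₛ} {partialSum e 0 0} {1ₛ}
                                          (PS.trans {1ₛ ^ₛ 2} {1ₛ *ₛ 1ₛ} {1ₛ} (PS.*-identityˡ (1ₛ *ₛ 1ₛ)) (PS.*-identityˡ 1ₛ))
                                          (empty-sum e t≤et) ⟩
      1ₛ *ₛ 1ₛ                       ≈⟨ PS.*-identityˡ 1ₛ ⟩
      1ₛ                             ∎
      where open PSReasoning

  -- `partialSum-convergent` is defined by cases on `k`, so its modulus reduces only after the same
  -- split.
  modulus≡suc : ∀ k m → Convergent.modulus (partialSum-convergent e t≤et k) m ≡ suc m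
  modulus≡suc zero    m = refl
  modulus≡suc (suc k) m = refl

  S-leadingTerm : ∀ k → ⦅ p ⨾ p ⦆∞ {p₀} *ₛ (⦅ q ⨾ p ⦆∞ {p₀} ^ₛ 2 *ₛ S k) ≈[ minExponent d (suc k) ] q ^ₛ minExponent d k
  S-leadingTerm k = begin
    ⦅ p ⨾ p ⦆∞ {p₀} *ₛ (⦅ q ⨾ p ⦆∞ {p₀} ^ₛ 2 *ₛ S k)
      -- The truncations, `K` for the outer product and `k + K` for the rest, fit `leadingTerm` at
      -- `r = K`; both are at least the precision `K`.
      ≈⟨ ≈[]-*-cong {x = H∞} {H K} {B∞ ^ₛ 2 *ₛ S k} {P k N} (⦅⦆∞-≈[] {K} p p {p₀} ℕ.≤-refl)
           (≈[]-*-cong {x = B∞ ^ₛ 2} {B N ^ₛ 2} {S k} {partialSum e k N}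
             (≈[]-^-cong {x = B∞} {B N} 2 (⦅⦆∞-≈[] {K} q p {p₀} (ℕ.m≤n+m K k)))
             (lim-≈[] (partialSum e k) (partialSum-convergent e t≤et k)
               λ m m<K → ℕ.≤-trans (ℕ.≤-reflexive (modulus≡suc k m)) (ℕ.≤-trans m<K (ℕ.m≤n+m K k)))) ⟩
    H K *ₛ P k (k ℕ.+ K)
      ≈⟨ leadingTerm {q} Oq {d} {p} p≈q^d H Q (λ _ → refl) (λ _ _ → refl) Q≈q^ P
           (λ r → constant-1⇒≈[1] {H r *ₛ P 0 r} (*ₛ-constant-1 (H r) (P 0 r) (pochhammer-constant p p r p₀) (P-zero-constant r)))
           P-zero-zero (λ _ → PS.zeroʳ (1ₛ ^ₛ 2)) P-suc k K ⟩
    q ^ₛ minExponent d k ∎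
    where
    K = minExponent d (suc k)
    N = k ℕ.+ K
    H∞ = ⦅ p ⨾ p ⦆∞ {p₀}
    B∞ = ⦅ q ⨾ p ⦆∞ {p₀}
    open SetoidReasoning (≈[]-setoid K)

open Products q-adic
open PentagonalNumberTheorem q-adic using (pentagonalSum; pentagonalNumberTheorem)

-- Sums over intervals of integers

-- A start and a length, rather than two bounds, so that intervals are cut and joined by adding
-- lengths and empty ones need no special case.
segment : ℤ → ℕ → (ℤ → PowerSeries) → PowerSeries
segment lo zero      F = 0ₛ
segment lo (suc len) F = F lo +ₛ segment (lo + 1ℤ) len F

segment-++ : ∀ lo a b F → segment lo (a ℕ.+ b) F ≈ₛ segment lo a F +ₛ segment (lo + + a) b F
segment-++ lo zero    b F m = trans (cong (λ x → segment x b F m) (sym (ℤ.+-identityʳ lo))) (sym (ℤ.+-identityˡ _))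
segment-++ lo (suc a) b F m = begin
  F lo m + segment (lo + 1ℤ) (a ℕ.+ b) F m
    ≡⟨ cong (λ x → F lo m + x) (segment-++ (lo + 1ℤ) a b F m) ⟩
  F lo m + (segment (lo + 1ℤ) a F m + segment (lo + 1ℤ + + a) b F m)
    ≡⟨ ℤ.+-assoc (F lo m) _ _ ⟨
  segment lo (suc a) F m + segment (lo + 1ℤ + + a) b F m
    ≡⟨ cong (λ x → segment lo (suc a) F m + segment x b F m) (ℤ.+-assoc lo 1ℤ (+ a)) ⟩
  segment lo (suc a) F m + segment (lo + + suc a) b F m ∎
  where open ≡-Reasoning

segment-O : ∀ {K} lo len F → (∀ i → i ℕ.< len → O[q^ K ] (F (lo + + i))) → O[q^ K ] (segment lo len F)
segment-O lo zero      F OF m m<K = refl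
segment-O lo (suc len) F OF m m<K = cong₂ _+_
  (trans (cong (λ x → F x m) (sym (ℤ.+-identityʳ lo))) (OF 0 (s≤s z≤n) m m<K))
  (segment-O (lo + 1ℤ) len F
    (λ i i<len m m<K → trans (cong (λ x → F x m) (ℤ.+-assoc lo 1ℤ (+ i))) (OF (suc i) (s≤s i<len) m m<K)) m m<K)

segment-extend : ∀ {K} lo a len b F →
  (∀ k → k < lo + + a ⊎ lo + + a + + len ≤ k → O[q^ K ] (F k)) →
  ∀ m → m ℕ.< K → segment lo (a ℕ.+ (len ℕ.+ b)) F m ≡ segment (lo + + a) len F m
segment-extend {K} lo a len b F OF m m<K = begin
  segment lo (a ℕ.+ (len ℕ.+ b)) F m
    ≡⟨ segment-++ lo a (len ℕ.+ b) F m ⟩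
  segment lo a F m + segment (lo + + a) (len ℕ.+ b) F m
    ≡⟨ cong₂ _+_
         (segment-O lo a F (λ i i<a → OF (lo + + i) (inj₁ (ℤ.+-monoʳ-< lo (ℤ.+<+ i<a)))) m m<K)
         (segment-++ (lo + + a) len b F m) ⟩
  0ℤ + (segment (lo + + a) len F m + segment (lo + + a + + len) b F m)
    ≡⟨ ℤ.+-identityˡ _ ⟩
  segment (lo + + a) len F m + segment (lo + + a + + len) b F m
    ≡⟨ cong (λ x → segment (lo + + a) len F m + x)
         (segment-O (lo + + a + + len) b F (λ i _ → OF _ (inj₂ (ℤ.i≤i+j (lo + + a + + len) (+ i)))) m m<K) ⟩
  segment (lo + + a) len F m + 0ℤ
    ≡⟨ ℤ.+-identityʳ _ ⟩
  segment (lo + + a) len F m ∎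
  where open ≡-Reasoning

sumOver-integersBetween : ∀ lo hi F →
  sumOver (integersBetween lo hi) F ≡ segment lo ∣ 0ℤ ⊔ (hi - lo + 1ℤ) ∣ F
sumOver-integersBetween lo hi F =
  trans (sumOver-map (λ i → lo + + i) (upTo len) F) (sumOver-applyUpTo len id lo (λ _ → refl))
  where
  len = ∣ 0ℤ ⊔ (hi - lo + 1ℤ) ∣
  sumOver-applyUpTo : ∀ len g lo′ → (∀ i → lo + + g i ≡ lo′ + + i) →
    sumOver (applyUpTo g len) (λ i → F (lo + + i)) ≡ segment lo′ len F
  sumOver-applyUpTo zero      g lo′ eq = refl
  sumOver-applyUpTo (suc len) g lo′ eq = cong₂ _+ₛ_
    (cong F (trans (eq 0) (ℤ.+-identityʳ lo′)))
    (sumOver-applyUpTo len (g ∘ suc) (lo′ + 1ℤ) (λ i → trans (eq (suc i)) (sym (ℤ.+-assoc lo′ 1ℤ (+ i)))))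

-- Summands of the wrong parity become zero instead of being filtered out, so the range stays a
-- contiguous interval that can be extended.
restrict : ∀ {P : Set} → Dec P → PowerSeries → PowerSeries
restrict (yes _) f = f
restrict (no _)  f = 0ₛ

sumOver-filter : ∀ {I : Set} {P : I → Set} (P? : ∀ i → Dec (P i)) is f →
                 sumOver (filter P? is) f ≈ₛ sumOver is (λ i → restrict (P? i) (f i))
sumOver-filter P? []       f m = refl
sumOver-filter P? (i ∷ is) f m with P? i
... | yes _ = cong (λ x → f i m + x) (sumOver-filter P? is f m)
... | no _  = trans (sumOver-filter P? is f m) (sym (ℤ.+-identityˡ _))

-- Integers outside the bounds `r₁` and `r₂`

square-antitone : ∀ {x y} → x ≤ y → y ≤ 0ℤ → y * y ≤ x * x
square-antitone {x} {y} x≤y y≤0 = begin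
  y * y           ≡⟨ neg-square y ⟩
  (- y) * (- y)   ≤⟨ ℤ.*-monoʳ-≤-nonNeg (- y) {{ℤ.nonNegative (ℤ.neg-mono-≤ y≤0)}} (ℤ.neg-mono-≤ x≤y) ⟩
  (- x) * (- y)   ≤⟨ ℤ.*-monoˡ-≤-nonNeg (- x) {{ℤ.nonNegative (ℤ.neg-mono-≤ (ℤ.≤-trans x≤y y≤0))}} (ℤ.neg-mono-≤ x≤y) ⟩
  (- x) * (- x)   ≡⟨ neg-square x ⟨
  x * x           ∎
  where
  open ℤ.≤-Reasoning
  neg-square : ∀ x → x * x ≡ (- x) * (- x)
  neg-square = solve-∀

-- Here `c k - a ≤ c m - a ≤ -√D`, and on nonpositive integers squaring reverses the order.
≤surd⁻⇒square : ∀ {a D c k m} .{{_ : ℕ.NonZero c}} → k ≤ m → m ≤ˢ surd a Sign.- D c →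
                + D ≤ (+ c * k - a) * (+ c * k - a)
≤surd⁻⇒square {a} {D} {c} k≤m (m≤0 , D≤m²) =
  ℤ.≤-trans D≤m² (square-antitone (ℤ.+-monoˡ-≤ (- a) (ℤ.*-monoˡ-≤-nonNeg (+ c) k≤m)) m≤0)

i<j+1⇒i≤j : ∀ {i j} → i < j + 1ℤ → i ≤ j
i<j+1⇒i≤j {i} {j} i<j+1 = subst (i ≤_) (cancel j) (ℤ.i<j⇒i≤pred[j] i<j+1)
  where
  cancel : ∀ j → -1ℤ + (j + 1ℤ) ≡ j
  cancel = solve-∀

i-1<j⇒i≤j : ∀ {i j} → i - 1ℤ < j → i ≤ j
i-1<j⇒i≤j {i} {j} i-1<j = subst (_≤ j) (cancel i) (ℤ.i<j⇒suc[i]≤j i-1<j)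
  where
  cancel : ∀ i → 1ℤ + (i - 1ℤ) ≡ i
  cancel = solve-∀

<1+floor⇒square : ∀ {a D c k m} .{{_ : ℕ.NonZero c}} → IsFloor (surd a Sign.- D c) m → k < m + 1ℤ →
                  + D ≤ (+ c * k - a) * (+ c * k - a)
<1+floor⇒square {a} {D} {c} {k} {m} (m≤x , _) k<m+1 = ≤surd⁻⇒square {a} {D} {c} {k} {m} (i<j+1⇒i≤j k<m+1) m≤x

-- An upper bound for a surd is by definition a lower bound for its negative, so the case of the
-- floor applies to `- k` and `- m`.
>ceiling-1⇒square : ∀ {a D c k m} .{{_ : ℕ.NonZero c}} → IsCeiling (surd a Sign.+ D c) m → m - 1ℤ < k →
                    + D ≤ (+ c * k - a) * (+ c * k - a)
>ceiling-1⇒square {a} {D} {c} {k} {m} (_ , x≤m) m-1<k = subst (+ D ≤_) (neg-square (+ c) k a)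
  (≤surd⁻⇒square { - a} {D} {c} { - k} { - m} (ℤ.neg-mono-≤ (i-1<j⇒i≤j m-1<k)) x≤m)
  where
  neg-square : ∀ c k a → (c * (- k) - (- a)) * (c * (- k) - (- a)) ≡ (c * k - a) * (c * k - a)
  neg-square = solve-∀

outside⇒square : ∀ n k → k < r₁ n ⊎ r₂ n < k →
  + (12 ℕ.* n ℕ.+ 13) ≤ (+ 3 * k - (+ (3 ℕ.* n) - 1ℤ)) * (+ 3 * k - (+ (3 ℕ.* n) - 1ℤ))
outside⇒square n k (inj₁ k<r₁) = <1+floor⇒square {+ (3 ℕ.* n) - 1ℤ} {12 ℕ.* n ℕ.+ 13} {3} {k} {floor x} (proj₂ ⌊ x ⌋ˢ) k<r₁
  where x = surd (+ (3 ℕ.* n) - 1ℤ) Sign.- (12 ℕ.* n ℕ.+ 13) 3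
outside⇒square n k (inj₂ r₂<k) = >ceiling-1⇒square {+ (3 ℕ.* n) - 1ℤ} {12 ℕ.* n ℕ.+ 13} {3} {k} {ceiling x} (proj₂ ⌈ x ⌉ˢ) r₂<k
  where x = surd (+ (3 ℕ.* n) - 1ℤ) Sign.+ (12 ℕ.* n ℕ.+ 13) 3

-- Exponents

i*2/2≡i : ∀ i → (i * + 2) / + 2 ≡ i
i*2/2≡i (+ n) = trans (ℤ.*-identityˡ _) (trans (cong (ℤ._/ℕ 2) (sym (ℤ.pos-* n 2))) (cong +_ (ℕ.m*n/n≡m n 2)))
i*2/2≡i -[1+ n ] rewrite ℕ.m*n%n≡0 (suc n) 2 {{ℕ.nonZero}} | ℕ.m*n/n≡m (suc n) 2 {{ℕ.nonZero}} = ℤ.*-identityˡ -[1+ n ]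

i<j⇒i-j<0 : ∀ {i j} → i < j → i - j < 0ℤ
i<j⇒i-j<0 {i} {j} i<j = subst (i - j <_) (ℤ.i≡j⇒i-j≡0 {j} refl) (ℤ.+-monoˡ-< (- j) i<j)

2∤1+2i : ∀ i → ¬ + 2 ∣ (+ 2 * i + 1ℤ)
2∤1+2i i 2∣ with ℕ.∣1⇒≡1 (∣⇒∣ᵤ (∣m+n∣m⇒∣n 2∣ (divides i (ℤ.*-comm (+ 2) i))))
... | ()

minExponent-1 : ∀ k → 2 ℕ.* minExponent 1 k ≡ k ℕ.* k ℕ.+ k
minExponent-1 zero    = refl
minExponent-1 (suc k) = trans (ℕ.*-distribˡ-+ 2 (minExponent 1 k) _)
  (trans (cong (ℕ._+ (2 ℕ.* suc (1 ℕ.* k))) (minExponent-1 k)) (rearrange k))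
  where
  rearrange : ∀ k → k ℕ.* k ℕ.+ k ℕ.+ 2 ℕ.* suc (1 ℕ.* k) ≡ suc k ℕ.* suc k ℕ.+ suc k
  rearrange = ℕ-Solver.solve-∀

minExponent-2 : ∀ k → minExponent 2 k ≡ k ℕ.* k
minExponent-2 zero    = refl
minExponent-2 (suc k) = trans (cong (ℕ._+ suc (2 ℕ.* k)) (minExponent-2 k)) (rearrange k)
  where
  rearrange : ∀ k → k ℕ.* k ℕ.+ suc (2 ℕ.* k) ≡ suc k ℕ.* suc k
  rearrange = ℕ-Solver.solve-∀

2*pent⁺ : ∀ l → 2 ℕ.* pent⁺ l ≡ 3 ℕ.* l ℕ.* l ℕ.+ l
2*pent⁺ zero    = refl
2*pent⁺ (suc l) = trans (ℕ.*-distribˡ-+ 2 (pent⁺ l) _) (trans (cong (ℕ._+ 2 ℕ.* suc (suc (3 ℕ.* l))) (2*pent⁺ l)) (rearrange l))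
  where
  rearrange : ∀ l → 3 ℕ.* l ℕ.* l ℕ.+ l ℕ.+ 2 ℕ.* suc (suc (3 ℕ.* l)) ≡ 3 ℕ.* suc l ℕ.* suc l ℕ.+ suc l
  rearrange = ℕ-Solver.solve-∀

2*pent⁻ : ∀ l → 2 ℕ.* pent⁻ l ℕ.+ suc l ≡ 3 ℕ.* suc l ℕ.* suc l
2*pent⁻ l = trans (cong (ℕ._+ suc l) (trans (ℕ.*-distribˡ-+ 2 (pent⁺ l) _) (cong (ℕ._+ 2 ℕ.* suc (l ℕ.+ l)) (2*pent⁺ l)))) (rearrange l)
  where
  rearrange : ∀ l → 3 ℕ.* l ℕ.* l ℕ.+ l ℕ.+ 2 ℕ.* suc (l ℕ.+ l) ℕ.+ suc l ≡ 3 ℕ.* suc l ℕ.* suc l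
  rearrange = ℕ-Solver.solve-∀

l≤2*pent⁺ : ∀ l → l ℕ.≤ 2 ℕ.* pent⁺ l
l≤2*pent⁺ l = subst (l ℕ.≤_) (sym (2*pent⁺ l)) (ℕ.m≤n+m l (3 ℕ.* l ℕ.* l))

l<pent⁻ : ∀ l → l ℕ.< pent⁻ l
l<pent⁻ l = ℕ.≤-trans (s≤s (ℕ.m≤m+n l l)) (ℕ.m≤n+m (suc (l ℕ.+ l)) (pent⁺ l))

-- The least exponent of A i *ₛ C j.
order : ℕ → ℕ → ℕ
order i j = minExponent 1 i ℕ.+ minExponent 2 j

2*order : ∀ i j → 2 ℕ.* order i j ≡ i ℕ.* i ℕ.+ i ℕ.+ 2 ℕ.* (j ℕ.* j)
2*order i j = trans (ℕ.*-distribˡ-+ 2 (minExponent 1 i) (minExponent 2 j))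
  (cong₂ ℕ._+_ (minExponent-1 i) (cong (2 ℕ.*_) (minExponent-2 j)))

pentℤ : ℤ → ℕ
pentℤ (+ l)    = pent⁺ l
pentℤ -[1+ l ] = pent⁻ l

2*pentℤ : ∀ c → + (2 ℕ.* pentℤ c) ≡ + 3 * c * c + c
2*pentℤ (+ l) = begin
  + (2 ℕ.* pent⁺ l)               ≡⟨ cong +_ (2*pent⁺ l) ⟩
  + (3 ℕ.* l ℕ.* l) + + l         ≡⟨ cong (λ x → x + + l) (trans (ℤ.pos-* (3 ℕ.* l) l) (cong (λ x → x * + l) (ℤ.pos-* 3 l))) ⟩
  + 3 * + l * + l + + l           ∎
  where open ≡-Reasoning
2*pentℤ -[1+ l ] = begin
  + (2 ℕ.* pent⁻ l)                                     ≡⟨ add-subtract (+ (2 ℕ.* pent⁻ l)) (+ suc l) ⟩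
  + (2 ℕ.* pent⁻ l ℕ.+ suc l) + -[1+ l ]                ≡⟨ cong (λ x → + x + -[1+ l ]) (2*pent⁻ l) ⟩
  + (3 ℕ.* suc l ℕ.* suc l) + -[1+ l ]
    ≡⟨ cong (λ x → x + -[1+ l ]) (trans (ℤ.pos-* (3 ℕ.* suc l) (suc l)) (cong (λ x → x * + suc l) (ℤ.pos-* 3 (suc l)))) ⟩
  + 3 * + suc l * + suc l + -[1+ l ]                    ≡⟨ cong (λ x → x + -[1+ l ]) (neg-square (+ suc l)) ⟩
  + 3 * -[1+ l ] * -[1+ l ] + -[1+ l ]                  ∎
  where
  open ≡-Reasoning
  add-subtract : ∀ x y → x ≡ x + y + (- y)
  add-subtract = solve-∀
  neg-square : ∀ x → + 3 * x * x ≡ + 3 * (- x) * (- x)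
  neg-square = solve-∀

pentℤ-square : ∀ c → (+ 6 * c + 1ℤ) * (+ 6 * c + 1ℤ) ≡ + (12 ℕ.* (2 ℕ.* pentℤ c) ℕ.+ 1)
pentℤ-square c = begin
  (+ 6 * c + 1ℤ) * (+ 6 * c + 1ℤ)      ≡⟨ rearrange c ⟩
  + 12 * (+ 3 * c * c + c) + 1ℤ        ≡⟨ cong (λ x → + 12 * x + 1ℤ) (2*pentℤ c) ⟨
  + 12 * + (2 ℕ.* pentℤ c) + 1ℤ        ≡⟨ cong (λ x → x + 1ℤ) (ℤ.pos-* 12 (2 ℕ.* pentℤ c)) ⟨
  + (12 ℕ.* (2 ℕ.* pentℤ c) ℕ.+ 1)     ∎
  where
  open ≡-Reasoning
  rearrange : ∀ c → (+ 6 * c + 1ℤ) * (+ 6 * c + 1ℤ) ≡ + 12 * (+ 3 * c * c + c) + 1ℤ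
  rearrange = solve-∀

-- With `n = l + j` the indices are `n + 2l` and `n - l`. Doubling removes the halves from the
-- triangular and pentagonal numbers.
order⁺ : ∀ l j → order (3 ℕ.* l ℕ.+ j) j ≡ order (l ℕ.+ j) (l ℕ.+ j) ℕ.+ 2 ℕ.* pent⁺ l
order⁺ l j = ℕ.*-cancelˡ-≡ _ _ 2 (begin
  2 ℕ.* order (3 ℕ.* l ℕ.+ j) j   ≡⟨ 2*order (3 ℕ.* l ℕ.+ j) j ⟩
  _                               ≡⟨ rearrange l j ⟩
  _                               ≡⟨ cong₂ ℕ._+_ (2*order (l ℕ.+ j) (l ℕ.+ j)) (cong (2 ℕ.*_) (2*pent⁺ l)) ⟨
  2 ℕ.* order (l ℕ.+ j) (l ℕ.+ j) ℕ.+ 2 ℕ.* (2 ℕ.* pent⁺ l)  ≡⟨ ℕ.*-distribˡ-+ 2 (order (l ℕ.+ j) (l ℕ.+ j)) _ ⟨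
  2 ℕ.* (order (l ℕ.+ j) (l ℕ.+ j) ℕ.+ 2 ℕ.* pent⁺ l) ∎)
  where
  open ≡-Reasoning
  rearrange : ∀ l j → let i = 3 ℕ.* l ℕ.+ j; n = l ℕ.+ j in
    i ℕ.* i ℕ.+ i ℕ.+ 2 ℕ.* (j ℕ.* j) ≡ n ℕ.* n ℕ.+ n ℕ.+ 2 ℕ.* (n ℕ.* n) ℕ.+ 2 ℕ.* (3 ℕ.* l ℕ.* l ℕ.+ l)
  rearrange = ℕ-Solver.solve-∀

-- The indices are `n - 2(l+1)` and `n + (l+1)`. Besides doubling, `2 * suc l` is added to both
-- sides, because `2 * pent⁻ l` equals `3(l+1)² - (l+1)` and involves a subtraction.
order⁻ : ∀ l i → let n = 2 ℕ.* suc l ℕ.+ i in order i (suc l ℕ.+ n) ≡ order n n ℕ.+ 2 ℕ.* pent⁻ l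
order⁻ l i = ℕ.*-cancelˡ-≡ _ _ 2 (ℕ.+-cancelʳ-≡ (2 ℕ.* suc l) _ _ (begin
  2 ℕ.* order i (suc l ℕ.+ n) ℕ.+ 2 ℕ.* suc l    ≡⟨ cong (ℕ._+ 2 ℕ.* suc l) (2*order i (suc l ℕ.+ n)) ⟩
  _                                              ≡⟨ rearrange l i ⟩
  _                                              ≡⟨ cong₂ ℕ._+_ (2*order n n) (cong (2 ℕ.*_) (2*pent⁻ l)) ⟨
  2 ℕ.* order n n ℕ.+ 2 ℕ.* (2 ℕ.* pent⁻ l ℕ.+ suc l)  ≡⟨ regroup (order n n) (2 ℕ.* pent⁻ l) (suc l) ⟩
  2 ℕ.* (order n n ℕ.+ 2 ℕ.* pent⁻ l) ℕ.+ 2 ℕ.* suc l ∎))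
  where
  open ≡-Reasoning
  n = 2 ℕ.* suc l ℕ.+ i
  rearrange : ∀ l i → let n = 2 ℕ.* suc l ℕ.+ i; j = suc l ℕ.+ n in
    i ℕ.* i ℕ.+ i ℕ.+ 2 ℕ.* (j ℕ.* j) ℕ.+ 2 ℕ.* suc l ≡ n ℕ.* n ℕ.+ n ℕ.+ 2 ℕ.* (n ℕ.* n) ℕ.+ 2 ℕ.* (3 ℕ.* suc l ℕ.* suc l)
  rearrange = ℕ-Solver.solve-∀
  regroup : ∀ a b c → 2 ℕ.* a ℕ.+ 2 ℕ.* (b ℕ.+ c) ≡ 2 ℕ.* (a ℕ.+ b) ℕ.+ 2 ℕ.* c
  regroup = ℕ-Solver.solve-∀

-- The terms of the sum

module PS^ = Algebra.Properties.Semiring.Exp PS.semiring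

A-leadingTerm : ∀ k → ⦅ q ⨾ q ⦆∞ {refl} *ₛ (⦅ q ⨾ q ⦆∞ {refl} ^ₛ 2 *ₛ A k) ≈[ minExponent 1 (suc k) ] q ^ₛ minExponent 1 k
A-leadingTerm = S-leadingTerm {1} q refl (PS.sym {q ^ₛ 1} {q} (PS.*-identityʳ q)) id (λ _ → ℕ.≤-refl)
  (λ N → cong suc (sym (ℕ.*-identityˡ N)))

C-leadingTerm : ∀ k → ⦅ q ^ₛ 2 ⨾ q ^ₛ 2 ⦆∞ {refl} *ₛ (⦅ q ⨾ q ^ₛ 2 ⦆∞ {refl} ^ₛ 2 *ₛ C k)
                      ≈[ minExponent 2 (suc k) ] q ^ₛ minExponent 2 k
C-leadingTerm = S-leadingTerm {2} (q ^ₛ 2) refl (λ _ → refl) odd t≤odd (λ N → ℕ.+-suc N (N ℕ.+ 0))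

H₂ : PowerSeries
H₂ = ⦅ q ^ₛ 2 ⨾ q ^ₛ 2 ⦆∞ {refl}

Θ₆≈ : Θ₆ ≈ₛ ⦅ q ⨾ q ⦆∞ {refl} PS^.^ 3 PS.* ⦅ q ⨾ q ^ₛ 2 ⦆∞ {refl} PS^.^ 2
Θ₆≈ = λ _ → refl

A*C-leadingTerm : ∀ {K} i j → K ℕ.≤ order (suc i) j → K ℕ.≤ order i (suc j) →
                  (Θ₆ *ₛ H₂) *ₛ (A i *ₛ C j) ≈[ K ] q ^ₛ order i j
A*C-leadingTerm {K} i j K≤ K≤′ =
  leading-product {q} {minExponent 1 i} {minExponent 1 (suc i)} {minExponent 2 j} {minExponent 2 (suc j)} {K}
    {Θ₆} {H₂} {⦅ q ⨾ q ⦆∞ {refl}} {⦅ q ⨾ q ^ₛ 2 ⦆∞ {refl}} {A i} {C j}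
    Oq (ℕ.m≤m+n (minExponent 1 i) _) K≤ K≤′ Θ₆≈ (A-leadingTerm i) (C-leadingTerm j)

-1^·ₛ : ∀ l f → (-1ℤ ^ l) ·ₛ f ≈ₛ (-ₛ 1ₛ) ^ₛ l *ₛ f
-1^·ₛ zero    f = PS.trans {1ℤ ·ₛ f} {f} {1ₛ *ₛ f} (λ m → ℤ.*-identityˡ (f m)) (PS.sym {1ₛ *ₛ f} {f} (PS.*-identityˡ f))
-1^·ₛ (suc l) f = begin
  (-1ℤ ^ suc l) ·ₛ f                      ≈⟨ (λ m → trans (ℤ.*-assoc -1ℤ (-1ℤ ^ l) (f m)) (ℤ.-1*i≡-i _)) ⟩
  -ₛ ((-1ℤ ^ l) ·ₛ f)                     ≈⟨ (λ m → cong -_ (-1^·ₛ l f m)) ⟩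
  -ₛ ((-ₛ 1ₛ) ^ₛ l *ₛ f)                  ≈⟨ -1*x≈-x ((-ₛ 1ₛ) ^ₛ l *ₛ f) ⟨
  (-ₛ 1ₛ) *ₛ ((-ₛ 1ₛ) ^ₛ l *ₛ f)          ≈⟨ PS.*-assoc (-ₛ 1ₛ) ((-ₛ 1ₛ) ^ₛ l) f ⟨
  (-ₛ 1ₛ) ^ₛ suc l *ₛ f                   ∎
  where
  open PSReasoning
  open import Algebra.Properties.Ring PS.ring using (-1*x≈-x)

term : ℕ → ℤ → PowerSeries
term n k = -1ℤ ^ ∣ (+ n - k) / + 2 ∣ ·ₛ (A ⟨ k ⟩ *ₛ C ⟨ (+ (3 ℕ.* n) - k) / + 2 ⟩)

baseExponent : ℕ → ℕ
baseExponent n = order n n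

-- For `k = n + 2c` both divisions by 2 are exact, with values `- c` and `n - c`, and the sign
-- depends only on the absolute value of `c`.
term-shape : ∀ n c → term n (+ n + + 2 * c) ≡ -1ℤ ^ ∣ c ∣ ·ₛ (A ⟨ + n + + 2 * c ⟩ *ₛ C ⟨ + n - c ⟩)
term-shape n c = cong₂ (λ x y → -1ℤ ^ x ·ₛ (A ⟨ + n + + 2 * c ⟩ *ₛ C ⟨ y ⟩))
  (trans (cong ∣_∣ (trans (cong (_/ + 2) (numerator (+ n) c)) (i*2/2≡i (- c)))) (ℤ.∣-i∣≡∣i∣ c))
  (trans (cong (_/ + 2) (trans (cong (λ x → x - (+ n + + 2 * c)) (ℤ.pos-* 3 n)) (numerator′ (+ n) c))) (i*2/2≡i (+ n - c)))
  where
  numerator : ∀ n c → n - (n + + 2 * c) ≡ - c * + 2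
  numerator = solve-∀
  numerator′ : ∀ n c → + 3 * n - (n + + 2 * c) ≡ (n - c) * + 2
  numerator′ = solve-∀

module _ (n : ℕ) where

  precision : ℕ
  precision = baseExponent n ℕ.+ suc n

  -- Raising `i` by one raises `order i j` by `suc i`, and raising `j` raises it by `suc (2 * j)`.
  -- The last two hypotheses say that either increase carries `e′` up to `precision`.
  in-range : ∀ {k k′} e {e′} i j → k ≡ + i → k′ ≡ + j → order i j ≡ e′ → e′ ≡ baseExponent n ℕ.+ e →
             n ℕ.≤ e ℕ.+ i → n ℕ.≤ e ℕ.+ 2 ℕ.* j →
             (Θ₆ *ₛ H₂) *ₛ (A ⟨ k ⟩ *ₛ C ⟨ k′ ⟩) ≈[ precision ] q ^ₛ e′
  in-range e i j refl refl refl order≡ n≤i n≤2j = A*C-leadingTerm {precision} i j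
    (subst (precision ℕ.≤_) (regroup₁ (minExponent 1 i) (minExponent 2 j) i) (bound i n≤i))
    (subst (precision ℕ.≤_) (regroup₂ (minExponent 1 i) (minExponent 2 j) j) (bound (2 ℕ.* j) n≤2j))
    where
    bound : ∀ x → n ℕ.≤ e ℕ.+ x → precision ℕ.≤ order i j ℕ.+ suc x
    bound x n≤ = ℕ.≤-trans (ℕ.+-monoʳ-≤ (baseExponent n) (s≤s n≤))
      (ℕ.≤-reflexive (trans (regroup (baseExponent n) e x) (cong (ℕ._+ suc x) (sym order≡))))
      where
      regroup : ∀ a b x → a ℕ.+ suc (b ℕ.+ x) ≡ a ℕ.+ b ℕ.+ suc x
      regroup = ℕ-Solver.solve-∀
    regroup₁ : ∀ a b i → a ℕ.+ b ℕ.+ suc i ≡ a ℕ.+ suc (1 ℕ.* i) ℕ.+ b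
    regroup₁ = ℕ-Solver.solve-∀
    regroup₂ : ∀ a b j → a ℕ.+ b ℕ.+ suc (2 ℕ.* j) ≡ a ℕ.+ (b ℕ.+ suc (2 ℕ.* j))
    regroup₂ = ℕ-Solver.solve-∀

  zero-product : ∀ {f g} → f ≡ 0ₛ ⊎ g ≡ 0ₛ → f *ₛ g ≈ₛ 0ₛ
  zero-product {g = g} (inj₁ refl) = PS.zeroˡ g
  zero-product {f}     (inj₂ refl) = PS.zeroʳ f

  -- A negative index makes the product zero by the convention of `_⟨_⟩`. The asymptotics stays
  -- true, since the predicted power already has order `precision`; it therefore holds for every
  -- integer `c`.
  out-of-range : ∀ e {f g} → f ≡ 0ₛ ⊎ g ≡ 0ₛ → suc n ℕ.≤ e →
                 (Θ₆ *ₛ H₂) *ₛ (f *ₛ g) ≈[ precision ] q ^ₛ (baseExponent n ℕ.+ e)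
  out-of-range e {f} {g} vanishes n< = zero-asymptotics {precision} {Θ₆ *ₛ H₂} {f *ₛ g} (zero-product vanishes)
    (Filtration.O-≤ q-adic {x = q ^ₛ (baseExponent n ℕ.+ e)} (ℕ.+-monoʳ-≤ (baseExponent n) n<) (O-^ {q} (baseExponent n ℕ.+ e) Oq))

  negative-index : ∀ {F i} → i < 0ℤ → F ⟨ i ⟩ ≡ 0ₛ
  negative-index {i = + _} (ℤ.+<+ ())
  negative-index {i = -[1+ _ ]} _ = refl

  A*C-Asymptotics : ℤ → Set
  A*C-Asymptotics c = (Θ₆ *ₛ H₂) *ₛ (A ⟨ + n + + 2 * c ⟩ *ₛ C ⟨ + n - c ⟩) ≈[ precision ] q ^ₛ (baseExponent n ℕ.+ 2 ℕ.* pentℤ c)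

  A*C-asymptotics⁺ : ∀ l → Dec (l ℕ.≤ n) → A*C-Asymptotics (+ l)
  A*C-asymptotics⁺ l (yes l≤n) = in-range (2 ℕ.* pent⁺ l) (3 ℕ.* l ℕ.+ j) j
      (trans (cong (λ x → + x + + 2 * + l) n≡) (trans (cong (λ x → + (l ℕ.+ j) + x) (sym (ℤ.pos-* 2 l))) (cong +_ (k≡ l j))))
      (trans (cong (λ x → + x - + l) n≡) (j≡ (+ l) (+ j)))
      (trans (order⁺ l j) (cong (λ x → baseExponent x ℕ.+ 2 ℕ.* pent⁺ l) (sym n≡))) refl
      (ℕ.≤-trans (ℕ.≤-reflexive n≡) (ℕ.≤-trans (ℕ.+-monoˡ-≤ j (ℕ.m≤n*m l 3)) (ℕ.m≤n+m (3 ℕ.* l ℕ.+ j) (2 ℕ.* pent⁺ l))))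
      (ℕ.≤-trans (ℕ.≤-reflexive n≡) (ℕ.+-mono-≤ (l≤2*pent⁺ l) (ℕ.m≤n*m j 2)))
    where
    j = n ∸ l
    n≡ : n ≡ l ℕ.+ j
    n≡ = sym (ℕ.m+[n∸m]≡n l≤n)
    k≡ : ∀ l j → l ℕ.+ j ℕ.+ 2 ℕ.* l ≡ 3 ℕ.* l ℕ.+ j
    k≡ = ℕ-Solver.solve-∀
    j≡ : ∀ l j → (l + j) - l ≡ j
    j≡ = solve-∀
  A*C-asymptotics⁺ l (no l≰n) = out-of-range (2 ℕ.* pent⁺ l) {A ⟨ + n + + 2 * + l ⟩} {C ⟨ + n - + l ⟩}
      (inj₂ (negative-index {C} (i<j⇒i-j<0 (ℤ.+<+ (ℕ.≰⇒> l≰n)))))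
      (ℕ.≤-trans (ℕ.≰⇒> l≰n) (l≤2*pent⁺ l))

  A*C-asymptotics⁻ : ∀ l → Dec (2 ℕ.* suc l ℕ.≤ n) → A*C-Asymptotics -[1+ l ]
  A*C-asymptotics⁻ l (yes 2L≤n) = in-range (2 ℕ.* pent⁻ l) i (suc l ℕ.+ n)
      (trans (cong (λ x → + x + + 2 * -[1+ l ]) n≡) (trans (cong (λ x → x + + i + + 2 * -[1+ l ]) (ℤ.pos-* 2 (suc l))) (i≡ (+ suc l) (+ i))))
      (cong +_ (ℕ.+-comm n (suc l)))
      (trans (cong (λ x → order i (suc l ℕ.+ x)) n≡) (trans (order⁻ l i) (cong (λ x → baseExponent x ℕ.+ 2 ℕ.* pent⁻ l) (sym n≡)))) refl
      (ℕ.≤-trans (ℕ.≤-reflexive n≡) (ℕ.+-monoˡ-≤ i (ℕ.*-monoʳ-≤ 2 (l<pent⁻ l))))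
      (ℕ.≤-trans (ℕ.m≤n+m n (suc l)) (ℕ.≤-trans (ℕ.m≤n*m (suc l ℕ.+ n) 2) (ℕ.m≤n+m (2 ℕ.* (suc l ℕ.+ n)) (2 ℕ.* pent⁻ l))))
    where
    i = n ∸ 2 ℕ.* suc l
    n≡ : n ≡ 2 ℕ.* suc l ℕ.+ i
    n≡ = sym (ℕ.m+[n∸m]≡n 2L≤n)
    i≡ : ∀ L i → + 2 * L + i + + 2 * (- L) ≡ i
    i≡ = solve-∀
  A*C-asymptotics⁻ l (no 2L≰n) = out-of-range (2 ℕ.* pent⁻ l) {A ⟨ + n + + 2 * -[1+ l ] ⟩} {C ⟨ + n - -[1+ l ] ⟩}
      (inj₁ (negative-index {A} (subst (_< 0ℤ) (n-2L≡ (+ n) (+ suc l)) (i<j⇒i-j<0 n<2L))))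
      (ℕ.≤-trans (ℕ.≰⇒> 2L≰n) (ℕ.*-monoʳ-≤ 2 (l<pent⁻ l)))
    where
    n<2L : + n < + 2 * + suc l
    n<2L = subst (+ n <_) (ℤ.pos-* 2 (suc l)) (ℤ.+<+ (ℕ.≰⇒> 2L≰n))
    n-2L≡ : ∀ n L → n - + 2 * L ≡ n + + 2 * (- L)
    n-2L≡ = solve-∀

  A*C-asymptotics : ∀ c → A*C-Asymptotics c
  A*C-asymptotics (+ l)    = A*C-asymptotics⁺ l (l ℕ.≤? n)
  A*C-asymptotics -[1+ l ] = A*C-asymptotics⁻ l (2 ℕ.* suc l ℕ.≤? n)

  term-asymptotics : ∀ c → (Θ₆ *ₛ H₂) *ₛ term n (+ n + + 2 * c) ≈[ precision ] (-ₛ 1ₛ) ^ₛ ∣ c ∣ *ₛ q ^ₛ (baseExponent n ℕ.+ 2 ℕ.* pentℤ c)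
  term-asymptotics c = ≈[]-trans {precision} {(Θ₆ *ₛ H₂) *ₛ term n (+ n + + 2 * c)} {(Θ₆ *ₛ H₂) *ₛ (s *ₛ x)} {s *ₛ y}
    (≈⇒≈[] {precision} {(Θ₆ *ₛ H₂) *ₛ term n (+ n + + 2 * c)} {(Θ₆ *ₛ H₂) *ₛ (s *ₛ x)}
      (PS.*-congˡ {Θ₆ *ₛ H₂} {term n (+ n + + 2 * c)} {s *ₛ x}
        (subst (λ f → f ≈ₛ s *ₛ x) (sym (term-shape n c)) (-1^·ₛ ∣ c ∣ x))))
    (scale-sign {precision} {Θ₆ *ₛ H₂} {s} {x} {y} (A*C-asymptotics c))
    where
    s = (-ₛ 1ₛ) ^ₛ ∣ c ∣
    x = A ⟨ + n + + 2 * c ⟩ *ₛ C ⟨ + n - c ⟩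
    y = q ^ₛ (baseExponent n ℕ.+ 2 ℕ.* pentℤ c)

-- The witnesses are `|d| + d` and `|d| - d`; they let the two signed margins in `symmetric-cover`
-- be natural numbers.
abs-split : ∀ d → ∃₂ λ y z → + y ≡ d + + ∣ d ∣ × y ℕ.+ z ≡ 2 ℕ.* ∣ d ∣
abs-split (+ x)    = x ℕ.+ x , 0 , refl , trans (ℕ.+-identityʳ (x ℕ.+ x)) (cong (x ℕ.+_) (sym (ℕ.+-identityʳ x)))
abs-split -[1+ x ] = 0 , 2 ℕ.* suc x , sym (ℤ.n⊖n≡0 (suc x)) , refl

restrict-yes : ∀ {P : Set} (d : Dec P) f → P → restrict d f ≡ f
restrict-yes (yes _) f p = refl
restrict-yes (no ¬p) f p = contradiction p ¬p

restrict-no : ∀ {P : Set} (d : Dec P) f → ¬ P → restrict d f ≡ 0ₛ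
restrict-no (yes p) f ¬p = contradiction p ¬p
restrict-no (no _)  f ¬p = refl

restrict-O : ∀ {K} {P : Set} (d : Dec P) f → (P → O[q^ K ] f) → O[q^ K ] (restrict d f)
restrict-O (yes p) f Of = Of p
restrict-O (no _)  f Of = λ _ _ → refl

Θ₆-inverse : Θ₆ *ₛ Θ₆ ⁻¹ ≈ₛ 1ₛ
Θ₆-inverse = *ₛ-inverseʳ Θ₆ Θ₆-constant

H₂-inverse : H₂ *ₛ H₂ ⁻¹ ≈ₛ 1ₛ
H₂-inverse = *ₛ-inverseʳ H₂ refl

pentagonal≈H₂ : ∀ {k} L → k ℕ.≤ L → pentagonalSum (q ^ₛ 2) L ≈[ k ] H₂
pentagonal≈H₂ {k} L k≤L = ≈[]-trans {k} {pentagonalSum (q ^ₛ 2) L} {H L} {H₂}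
  (≈[]-≤ {k} {suc L} {pentagonalSum (q ^ₛ 2) L} {H L} (ℕ.m≤n⇒m≤1+n k≤L)
    (pentagonalNumberTheorem {q ^ₛ 2} (λ m m<1 → ^ₛ-order q 2 refl m (ℕ.≤-trans m<1 (s≤s z≤n))) H (λ r → H r ⁻¹)
      (λ _ → refl) (λ _ _ → refl) (λ r → *ₛ-inverseʳ (H r) (pochhammer-constant (q ^ₛ 2) (q ^ₛ 2) r refl)) L))
  (≈[]-sym {k} {H₂} {H L} (⦅⦆∞-≈[] {k} {L} (q ^ₛ 2) (q ^ₛ 2) {refl} k≤L))
  where
  H : ℕ → PowerSeries
  H = pochhammer (q ^ₛ 2) (q ^ₛ 2)

-- Comparison of the sum with a window symmetric about `n`

module _ (n : ℕ) where

  even? : ∀ k → Dec (+ 2 ∣ (k - + n))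
  even? k = + 2 ∣? (k - + n)

  evenTerm : ℤ → PowerSeries
  evenTerm k = restrict (even? k) (term n k)

  evenTerm-even : ∀ c → evenTerm (+ n + + 2 * c) ≡ term n (+ n + + 2 * c)
  evenTerm-even c = restrict-yes (even? (+ n + + 2 * c)) (term n (+ n + + 2 * c)) (divides c (difference (+ n) c))
    where
    difference : ∀ n c → (n + + 2 * c) - n ≡ c * + 2
    difference = solve-∀

  evenTerm-odd : ∀ c → evenTerm (+ n + + 2 * c + 1ℤ) ≡ 0ₛ
  evenTerm-odd c = restrict-no (even? (+ n + + 2 * c + 1ℤ)) (term n (+ n + + 2 * c + 1ℤ))
    (2∤1+2i c ∘ subst (+ 2 ∣_) (difference (+ n) c))
    where
    difference : ∀ n c → (n + + 2 * c + 1ℤ) - n ≡ + 2 * c + 1ℤ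
    difference = solve-∀

  -- `Θ₆ *ₛ H₂` is a unit, so the order of a term can be read off from its product with this unit.
  term-O : ∀ c → suc n ℕ.≤ 2 ℕ.* pentℤ c → O[q^ precision n ] (term n (+ n + + 2 * c))
  term-O c n< = O-cancel {precision n} {Θ₆} {H₂} {Θ₆ ⁻¹} {H₂ ⁻¹} {term n (+ n + + 2 * c)} Θ₆-inverse H₂-inverse
    (O-resp-≈[] {precision n} {(Θ₆ *ₛ H₂) *ₛ term n (+ n + + 2 * c)} {s *ₛ y} (term-asymptotics n c)
      (O-multiple {precision n} {y} s (Filtration.O-≤ q-adic {x = y} (ℕ.+-monoʳ-≤ (baseExponent n) n<) (O-^ {q} (baseExponent n ℕ.+ 2 ℕ.* pentℤ c) Oq))))
    where
    s = (-ₛ 1ₛ) ^ₛ ∣ c ∣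
    y = q ^ₛ (baseExponent n ℕ.+ 2 ℕ.* pentℤ c)

  outside⇒n<2*pentℤ : ∀ c → + n + + 2 * c < r₁ n ⊎ r₂ n < + n + + 2 * c → suc n ℕ.≤ 2 ℕ.* pentℤ c
  outside⇒n<2*pentℤ c outside = ℕ.*-cancelˡ-≤ 12 (ℕ.+-cancelʳ-≤ 1 (12 ℕ.* suc n) (12 ℕ.* (2 ℕ.* pentℤ c))
    (subst (ℕ._≤ 12 ℕ.* (2 ℕ.* pentℤ c) ℕ.+ 1) (12n+13 n)
      (ℤ.drop‿+≤+ (subst (+ (12 ℕ.* n ℕ.+ 13) ≤_) square≡ (outside⇒square n (+ n + + 2 * c) outside)))))
    where
    12n+13 : ∀ n → 12 ℕ.* n ℕ.+ 13 ≡ 12 ℕ.* suc n ℕ.+ 1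
    12n+13 = ℕ-Solver.solve-∀
    linear : ∀ n c → + 3 * (n + + 2 * c) - (+ 3 * n - 1ℤ) ≡ + 6 * c + 1ℤ
    linear = solve-∀
    linear′ : + 3 * (+ n + + 2 * c) - (+ (3 ℕ.* n) - 1ℤ) ≡ + 6 * c + 1ℤ
    linear′ = trans (cong (λ x → + 3 * (+ n + + 2 * c) - (x - 1ℤ)) (ℤ.pos-* 3 n)) (linear (+ n) c)
    square≡ : (+ 3 * (+ n + + 2 * c) - (+ (3 ℕ.* n) - 1ℤ)) * (+ 3 * (+ n + + 2 * c) - (+ (3 ℕ.* n) - 1ℤ))
              ≡ + (12 ℕ.* (2 ℕ.* pentℤ c) ℕ.+ 1)
    square≡ = trans (cong₂ _*_ linear′ linear′) (pentℤ-square c)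

  evenTerm-outside : ∀ k → k < r₁ n ⊎ r₂ n < k → O[q^ precision n ] (evenTerm k)
  evenTerm-outside k outside = restrict-O (even? k) (term n k) even
    where
    rearrange : ∀ k n → k ≡ n + (k - n)
    rearrange = solve-∀
    k≡ : ∀ c → k - + n ≡ c * + 2 → k ≡ + n + + 2 * c
    k≡ c eq = trans (rearrange k (+ n)) (cong (λ x → + n + x) (trans eq (ℤ.*-comm c (+ 2))))
    even : + 2 ∣ (k - + n) → O[q^ precision n ] (term n k)
    even (divides c eq) = subst (λ k → O[q^ precision n ] (term n k)) (sym (k≡ c eq))
      (term-O c (outside⇒n<2*pentℤ c (subst (λ k → k < r₁ n ⊎ r₂ n < k) (k≡ c eq) outside)))

  term⁺ term⁻ : ℕ → PowerSeries
  term⁺ l = term n (+ n + + 2 * + l)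
  term⁻ l = term n (+ n + + 2 * -[1+ l ])

  -- The number `4L + 1` of integers from `n - 2L` to `n + 2L`, in a recursive form that follows the
  -- window: each step adds two integers at either end, exactly one of them with the parity of `n`.
  symmetricLength : ℕ → ℕ
  symmetricLength zero    = 1
  symmetricLength (suc L) = suc (suc (symmetricLength L ℕ.+ 2))

  symmetricLength≡ : ∀ L → symmetricLength L ≡ 1 ℕ.+ 4 ℕ.* L
  symmetricLength≡ zero    = refl
  symmetricLength≡ (suc L) = trans (cong (λ x → suc (suc (x ℕ.+ 2))) (symmetricLength≡ L)) (rearrange L)
    where
    rearrange : ∀ L → suc (suc (1 ℕ.+ 4 ℕ.* L ℕ.+ 2)) ≡ 1 ℕ.+ 4 ℕ.* suc L
    rearrange = ℕ-Solver.solve-∀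

  segment-symmetric : ∀ L → segment (+ n + + 2 * (- + L)) (symmetricLength L) evenTerm ≈ₛ symmetricSum term⁺ term⁻ L
  segment-symmetric zero    m = trans (ℤ.+-identityʳ _) (cong (λ f → f m) (evenTerm-even 0ℤ))
  segment-symmetric (suc L) m = begin
    evenTerm lo′ m + (evenTerm (lo′ + 1ℤ) m + segment (lo′ + 1ℤ + 1ℤ) (symmetricLength L ℕ.+ 2) evenTerm m)
      ≡⟨ cong₂ _+_ (cong (λ f → f m) (evenTerm-even -[1+ L ]))
           (cong₂ _+_ (cong (λ f → f m) (evenTerm-odd -[1+ L ]))
             (trans (cong (λ x → segment x (symmetricLength L ℕ.+ 2) evenTerm m) (lo≡ (+ n) (+ L)))
               (segment-++ lo (symmetricLength L) 2 evenTerm m))) ⟩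
    term⁻ L m + (0ℤ + (segment lo (symmetricLength L) evenTerm m + (evenTerm hi m + (evenTerm (hi + 1ℤ) m + 0ℤ))))
      ≡⟨ cong₂ (λ x y → term⁻ L m + (0ℤ + (x + y))) (segment-symmetric L m)
           (cong₂ (λ x y → x + (y + 0ℤ))
             (cong (λ f → f m) (trans (cong evenTerm hi≡) (evenTerm-odd (+ L))))
             (cong (λ f → f m) (trans (cong evenTerm (trans (cong (_+ 1ℤ) hi≡) (next (+ n) (+ L)))) (evenTerm-even (+ suc L))))) ⟩
    term⁻ L m + (0ℤ + (symmetricSum term⁺ term⁻ L m + (0ℤ + (term⁺ (suc L) m + 0ℤ))))
      ≡⟨ rearrange (term⁻ L m) (symmetricSum term⁺ term⁻ L m) (term⁺ (suc L) m) ⟩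
    symmetricSum term⁺ term⁻ L m + (term⁺ (suc L) m + term⁻ L m) ∎
    where
    open ≡-Reasoning
    lo′ = + n + + 2 * -[1+ L ]
    lo = + n + + 2 * (- + L)
    hi = lo + + symmetricLength L
    lo≡ : ∀ n L → n + + 2 * (- (1ℤ + L)) + 1ℤ + 1ℤ ≡ n + + 2 * (- L)
    lo≡ = solve-∀
    hi≡ : hi ≡ + n + + 2 * + L + 1ℤ
    hi≡ = trans (cong (λ x → lo + x) (trans (cong +_ (symmetricLength≡ L)) (cong (λ x → 1ℤ + x) (ℤ.pos-* 4 L)))) (regroup (+ n) (+ L))
      where
      regroup : ∀ n L → n + + 2 * (- L) + (1ℤ + + 4 * L) ≡ n + + 2 * L + 1ℤ
      regroup = solve-∀
    next : ∀ n L → n + + 2 * L + 1ℤ + 1ℤ ≡ n + + 2 * (1ℤ + L)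
    next = solve-∀
    rearrange : ∀ a b c → a + (0ℤ + (b + (0ℤ + (c + 0ℤ)))) ≡ b + (c + a)
    rearrange = solve-∀

  symmetric-cover : ∀ lo len → ∃ λ L → suc n ℕ.≤ L × ∃₂ λ a b →
    (+ n + + 2 * (- + L)) + + a ≡ lo × a ℕ.+ (len ℕ.+ b) ≡ symmetricLength L
  symmetric-cover lo len with abs-split (lo - + n)
  -- `L` is at least `n + 1` for the sake of Euler's theorem, and large enough for the window to
  -- contain the interval. The left margin is `lo - n + 2L = y + e`, and the right margin is what
  -- remains of `4L + 1`.
  ... | y , z , y≡ , y+z≡ = L , ℕ.m≤m+n (suc n) (x ℕ.+ len) , y ℕ.+ e , z ℕ.+ suc (2 ℕ.* suc n ℕ.+ x ℕ.+ len) , lo≡ , length≡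
    where
    x = ∣ lo - + n ∣
    L = suc n ℕ.+ (x ℕ.+ len)
    e = 2 ℕ.* suc n ℕ.+ x ℕ.+ 2 ℕ.* len
    lo≡ : (+ n + + 2 * (- + L)) + (+ y + + e) ≡ lo
    lo≡ = begin
      (+ n + + 2 * (- + L)) + (+ y + + e)
        ≡⟨ cong₂ (λ u v → (+ n + + 2 * (- + L)) + (u + v)) y≡
             (cong₂ (λ u v → u + + x + v) (ℤ.pos-* 2 (suc n)) (ℤ.pos-* 2 len)) ⟩
      (+ n + + 2 * (- (+ suc n + (+ x + + len)))) + ((lo - + n + + x) + (+ 2 * + suc n + + x + + 2 * + len))
        ≡⟨ cancel lo (+ n) (+ suc n) (+ x) (+ len) ⟩
      lo ∎
      where
      open ≡-Reasoning
      cancel : ∀ l n s x k → (n + + 2 * (- (s + (x + k)))) + ((l - n + x) + (+ 2 * s + x + + 2 * k)) ≡ l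
      cancel = solve-∀
    length≡ : y ℕ.+ e ℕ.+ (len ℕ.+ (z ℕ.+ suc (2 ℕ.* suc n ℕ.+ x ℕ.+ len))) ≡ symmetricLength L
    length≡ = begin
      y ℕ.+ e ℕ.+ (len ℕ.+ (z ℕ.+ suc (2 ℕ.* suc n ℕ.+ x ℕ.+ len)))
        ≡⟨ regroup y z n x len ⟩
      suc ((y ℕ.+ z) ℕ.+ (4 ℕ.* suc n ℕ.+ 2 ℕ.* x ℕ.+ 4 ℕ.* len))
        ≡⟨ cong (λ w → suc (w ℕ.+ (4 ℕ.* suc n ℕ.+ 2 ℕ.* x ℕ.+ 4 ℕ.* len))) y+z≡ ⟩
      suc (2 ℕ.* x ℕ.+ (4 ℕ.* suc n ℕ.+ 2 ℕ.* x ℕ.+ 4 ℕ.* len))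
        ≡⟨ regroup′ n x len ⟩
      1 ℕ.+ 4 ℕ.* L
        ≡⟨ symmetricLength≡ L ⟨
      symmetricLength L ∎
      where
      open ≡-Reasoning
      regroup : ∀ y z n x k → y ℕ.+ (2 ℕ.* suc n ℕ.+ x ℕ.+ 2 ℕ.* k) ℕ.+ (k ℕ.+ (z ℕ.+ suc (2 ℕ.* suc n ℕ.+ x ℕ.+ k)))
                ≡ suc ((y ℕ.+ z) ℕ.+ (4 ℕ.* suc n ℕ.+ 2 ℕ.* x ℕ.+ 4 ℕ.* k))
      regroup = ℕ-Solver.solve-∀
      regroup′ : ∀ n x k → suc (2 ℕ.* x ℕ.+ (4 ℕ.* suc n ℕ.+ 2 ℕ.* x ℕ.+ 4 ℕ.* k)) ≡ 1 ℕ.+ 4 ℕ.* (suc n ℕ.+ (x ℕ.+ k))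
      regroup′ = ℕ-Solver.solve-∀

  symmetricSum-asymptotics : ∀ L → suc n ℕ.≤ L → symmetricSum term⁺ term⁻ L ≈[ precision n ] q ^ₛ baseExponent n *ₛ Θ₆ ⁻¹
  symmetricSum-asymptotics L n<L = ≈[]-cancel {precision n} {Θ₆} {H₂} {Θ₆ ⁻¹} {H₂ ⁻¹} {S₀} {q ^ₛ baseExponent n} Θ₆-inverse H₂-inverse
    (≈[]-trans {precision n} {(Θ₆ *ₛ H₂) *ₛ S₀} {q ^ₛ baseExponent n *ₛ pentagonalSum (q ^ₛ 2) L} {q ^ₛ baseExponent n *ₛ H₂}
      (symmetricSum≈pentagonalSum {precision n} {q} {baseExponent n} {Θ₆ *ₛ H₂} {term⁺} {term⁻}
        (λ l → term-asymptotics n (+ l)) (λ l → term-asymptotics n -[1+ l ]) L)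
      -- Euler's sum is used only up to `q^{n+1}`; the factor `q ^ₛ baseExponent n` lifts this to
      -- the full precision.
      (≈[]-*-multiple {baseExponent n} {suc n} {pentagonalSum (q ^ₛ 2) L} {H₂} {q ^ₛ baseExponent n} (O-^ {q} (baseExponent n) Oq) (pentagonal≈H₂ {suc n} L n<L)))
    where
    S₀ = symmetricSum term⁺ term⁻ L

  sum-asymptotics : ∀ m → m ℕ.< precision n → sumOver (indices n) (term n) m ≡ (q ^ₛ baseExponent n *ₛ Θ₆ ⁻¹) m
  sum-asymptotics m m<K = go (symmetric-cover (r₁ n) len)
    where
    len = ∣ 0ℤ ⊔ (r₂ n - r₁ n + 1ℤ) ∣
    -- This covers an empty range as well, since the maximum with 0 can only increase the length.
    r₂<r₁+len : r₂ n < r₁ n + + len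
    r₂<r₁+len = ℤ.suc[i]≤j⇒i<j (ℤ.≤-trans (ℤ.≤-reflexive (rearrange (r₁ n) (r₂ n)))
      (ℤ.+-monoʳ-≤ (r₁ n) (ℤ.≤-trans (ℤ.i≤j⊔i 0ℤ (r₂ n - r₁ n + 1ℤ)) (ℤ.≤-reflexive (sym (ℤ.0≤i⇒+∣i∣≡i (ℤ.i≤i⊔j 0ℤ (r₂ n - r₁ n + 1ℤ))))))))
      where
      rearrange : ∀ r s → 1ℤ + s ≡ r + (s - r + 1ℤ)
      rearrange = solve-∀
    go : (∃ λ L → suc n ℕ.≤ L × ∃₂ λ a b → (+ n + + 2 * (- + L)) + + a ≡ r₁ n × a ℕ.+ (len ℕ.+ b) ≡ symmetricLength L) →
         sumOver (indices n) (term n) m ≡ (q ^ₛ baseExponent n *ₛ Θ₆ ⁻¹) m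
    go (L , n<L , a , b , lo+a≡r₁ , length≡) = begin
      sumOver (indices n) (term n) m
        ≡⟨ sumOver-filter even? (integersBetween (r₁ n) (r₂ n)) (term n) m ⟩
      sumOver (integersBetween (r₁ n) (r₂ n)) evenTerm m
        ≡⟨ cong (λ f → f m) (sumOver-integersBetween (r₁ n) (r₂ n) evenTerm) ⟩
      segment (r₁ n) len evenTerm m
        ≡⟨ cong (λ x → segment x len evenTerm m) lo+a≡r₁ ⟨
      segment (lo + + a) len evenTerm m
        ≡⟨ segment-extend {precision n} lo a len b evenTerm outside m m<K ⟨
      segment lo (a ℕ.+ (len ℕ.+ b)) evenTerm m
        ≡⟨ cong (λ x → segment lo x evenTerm m) length≡ ⟩
      segment lo (symmetricLength L) evenTerm m
        ≡⟨ segment-symmetric L m ⟩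
      symmetricSum term⁺ term⁻ L m
        ≡⟨ ≈[]⇒≗ {precision n} {symmetricSum term⁺ term⁻ L} {q ^ₛ baseExponent n *ₛ Θ₆ ⁻¹} (symmetricSum-asymptotics L n<L) m m<K ⟩
      (q ^ₛ baseExponent n *ₛ Θ₆ ⁻¹) m ∎
      where
      open ≡-Reasoning
      lo = + n + + 2 * (- + L)
      outside : ∀ k → k < lo + + a ⊎ lo + + a + + len ≤ k → O[q^ precision n ] (evenTerm k)
      outside k (inj₁ k<) = evenTerm-outside k (inj₁ (subst (k <_) lo+a≡r₁ k<))
      outside k (inj₂ ≤k) = evenTerm-outside k (inj₂ (ℤ.<-≤-trans r₂<r₁+len (subst (λ x → x + + len ≤ k) lo+a≡r₁ ≤k)))

-- Division by the leading power and passage to Laurent series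

q^-shift : ∀ M f m → (q ^ₛ M *ₛ f) (M ℕ.+ m) ≡ f m
q^-shift zero    f m = *ₛ-identityˡ f m
q^-shift (suc M) f m = begin
  ((q *ₛ q ^ₛ M) *ₛ f) (suc (M ℕ.+ m))             ≡⟨ *ₛ-assoc q (q ^ₛ M) f (suc (M ℕ.+ m)) ⟩
  (q *ₛ (q ^ₛ M *ₛ f)) (suc (M ℕ.+ m))             ≡⟨ q*-shift (q ^ₛ M *ₛ f) (M ℕ.+ m) ⟩
  (q ^ₛ M *ₛ f) (M ℕ.+ m)                          ≡⟨ q^-shift M f m ⟩
  f m                                              ∎
  where
  open ≡-Reasoning
  tail-q : tail q ≈ₛ 1ₛ
  tail-q zero    = refl
  tail-q (suc _) = refl
  q*-shift : ∀ f m → (q *ₛ f) (suc m) ≡ f m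
  q*-shift f m = trans (ℤ.+-identityˡ ((tail q *ₛ f) m))
    (trans (*ₛ-cong {tail q} {1ₛ} {f} {f} tail-q (λ _ → refl) m) (*ₛ-identityˡ f m))

-- The numerator `3n² + n` is twice `order n n`, so the division is exact.
baseExponent≡ : ∀ n → (3 ℕ.* n ℕ.^ 2 ℕ.+ n) ℕ./ 2 ≡ baseExponent n
baseExponent≡ n = trans (cong (ℕ._/ 2) (trans (square n) (trans (sym (2*order n n)) (ℕ.*-comm 2 (baseExponent n))))) (ℕ.m*n/n≡m (baseExponent n) 2)
  where
  square : ∀ n → 3 ℕ.* n ℕ.^ 2 ℕ.+ n ≡ n ℕ.* n ℕ.+ n ℕ.+ 2 ℕ.* (n ℕ.* n)
  square n = trans (cong (λ x → 3 ℕ.* (n ℕ.* x) ℕ.+ n) (ℕ.*-identityʳ n)) (regroup n)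
    where
    regroup : ∀ n → 3 ℕ.* (n ℕ.* n) ℕ.+ n ≡ n ℕ.* n ℕ.+ n ℕ.+ 2 ℕ.* (n ℕ.* n)
    regroup = ℕ-Solver.solve-∀

embed-below : ∀ {M} f → O[q^ M ] f → ∀ i → i < + M → embed f i ≡ 0ℤ
embed-below f Of (+ m)    (ℤ.+<+ m<M) = Of m m<M
embed-below f Of -[1+ _ ] _           = refl

-- E collects the coefficients from q^M on, since f vanishes below q^M.
laurent-shift : ∀ {M k} f g → (∀ m → m ℕ.< M ℕ.+ k → f m ≡ (q ^ₛ M *ₛ g) m) →
  ∃ λ E → O[q^ k ] E × (embed g ≈ᴸ q^ - + M · embed f +ᴸ embed E)
laurent-shift {M} {k} f g f≗ = E , E-order , eq
  where
  E : PowerSeries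
  E m = g m - f (M ℕ.+ m)
  E-order : O[q^ k ] E
  E-order m m<k = ℤ.i≡j⇒i-j≡0 (sym (trans (f≗ (M ℕ.+ m) (ℕ.+-monoʳ-< M m<k)) (q^-shift M g m)))
  f-order : O[q^ M ] f
  f-order m m<M = trans (f≗ m (ℕ.<-≤-trans m<M (ℕ.m≤m+n M k))) (*ₛ-orderˡ (q ^ₛ M) g (^ₛ-order q M refl) m m<M)
  eq : embed g ≈ᴸ q^ - + M · embed f +ᴸ embed E
  eq (+ m)      = sym (trans (cong (λ x → embed f x + E m) shift) (cancel (f (M ℕ.+ m)) (g m)))
    where
    shift : + m - - + M ≡ + (M ℕ.+ m)
    shift = trans (cong (λ x → + m + x) (ℤ.neg-involutive (+ M))) (cong +_ (ℕ.+-comm m M))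
    cancel : ∀ x y → x + (y - x) ≡ y
    cancel = solve-∀
  eq e@(-[1+ m ]) = sym (trans (ℤ.+-identityʳ _) (embed-below f f-order (e - - + M)
    (subst (_< + M) (cong (λ x → e + x) (sym (ℤ.neg-involutive (+ M)))) (subst (e + + M <_) (ℤ.+-identityˡ (+ M)) (ℤ.+-monoˡ-< (+ M) (ℤ.-<+ {m} {0}))))))

lemma2p1 : (n : ℕ) → 0 ℕ.< n →
    ∃ λ (E : PowerSeries) → O[q^ suc n ] E ×
    (embed (1ₛ /ₛ Θ₆)
    ≈ᴸ
    q^ - + ((3 ℕ.* n ℕ.^ 2 ℕ.+ n) ℕ./ 2) · embed
    (sumOver (indices n) λ k →
    -1ℤ ^ ∣ (+ n - k) / + 2 ∣ ·ₛ (A ⟨ k ⟩ *ₛ C ⟨ (+ (3 ℕ.* n) - k) / + 2 ⟩))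
    +ᴸ embed E)
lemma2p1 n _ = subst
  (λ M → ∃ λ E → O[q^ suc n ] E × (embed (1ₛ /ₛ Θ₆) ≈ᴸ q^ - + M · embed (sumOver (indices n) (term n)) +ᴸ embed E))
  (sym (baseExponent≡ n))
  (laurent-shift (sumOver (indices n) (term n)) (1ₛ /ₛ Θ₆) λ m m<K → trans (sum-asymptotics n m m<K)
    (*ₛ-cong {q ^ₛ baseExponent n} {q ^ₛ baseExponent n} {Θ₆ ⁻¹} {1ₛ /ₛ Θ₆} (λ _ → refl) (λ m → sym (*ₛ-identityˡ (Θ₆ ⁻¹) m)) m))
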